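{- For each positive integer $n$, place $n$ bishops at random on the $n\times n$ chessboard, let $S_n$ be the number of safe spaces and let $\mu_n=\mathbb{E}[S_n]/n^2$ be the expected proportion of safe spaces. Then, as $n\to\infty$, $\mathbb{E}[S_n]$ is asymptotic to $2n^2/e^2$, and $\mu_n$ converges to $2/e^2$.
   Context: The $n\times n$ board is the set of spaces $\{1,\dots,n\}^2$. "Placing $n$ pieces at random" means that the set of occupied spaces (the board configuration) is chosen uniformly among all $\binom{n^2}{n}$ subsets of $n$ distinct spaces. A bishop at $(i,j)$ attacks every space $(x,y)$ on the board with $|x-i|=|y-j|$ (the two diagonals through $(i,j)$). A space is safe under a board configuration if it is neither occupied nor attacked by any of the placed pieces. -}

module Defs where

open import Data.Bool using (true; false)
open import Data.Fin using (Fin; toℕ; combine)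
open import Data.Fin.Properties using (all?)
open import Data.Fin.Subset using (Subset; inside; outside; _∈_; _∉_; ∣_∣)
open import Data.Fin.Subset.Properties using (_∈?_)
open import Data.Integer using (+_)
import Data.Integer as ℤ
import Data.Integer.Properties as ℤ
open import Data.List using (List; []; _∷_; [_]; _++_; map; filter; length; allFin; cartesianProduct)
open import Data.List.Membership.Propositional using () renaming (_∈_ to _∈ˡ_)
open import Data.List.Membership.Propositional.Properties using (∈-++⁺ˡ; ∈-++⁺ʳ; ∈-map⁺)
open import Data.List.Properties using (filter-++; length-++)
open import Data.List.Relation.Unary.Any using (here)
open import Data.Nat using (ℕ; zero; suc; NonZero; _!)
import Data.Nat as ℕ
open import Data.Nat.ListAction using (sum)
import Data.Nat.Properties as ℕ
import Data.Nat.Tactic.RingSolver as ℕ-Solver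
open import Data.Nat.Combinatorics using (_C_; nCk+nC[k+1]≡[n+1]C[k+1]; nCk≡n!/k![n-k]!; nCk≡nC[n∸k]; nCn≡1; k![n∸k]!∣n!)
open import Data.Nat.Divisibility using (∣⇒≤)
open import Data.Nat.DivMod using (m≥n⇒m/n>0)
open import Data.Product using (Σ; ∃; _×_; _,_)
open import Data.Rational using (ℚ; mkℚ; 0ℚ; 1ℚ; ½; _/_; _+_; _*_; _-_; -_; _≤_; _<_; 1/_; ↧ₙ_; positive; nonNegative; ≢-nonZero)
import Data.Rational as ℚ
import Data.Rational.Properties as ℚ
open import Data.Rational.Solver using (module +-*-Solver)
import Data.Rational.Unnormalised as ℚᵘ
import Data.Rational.Unnormalised.Properties as ℚᵘ
open import Data.Sum using (_⊎_; inj₁; inj₂)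
open import Data.Vec using ([]; _∷_)
open import Relation.Binary.PropositionalEquality using (_≡_; _≢_; refl; sym; trans; cong; cong₂; subst; subst₂; module ≡-Reasoning)
open import Relation.Nullary using (¬_; Dec; yes; no; ¬?; contradiction; _×-dec_; _→-dec_)
open import Relation.Unary using (Decidable)

private
  ∣_∣ℚ : ℚ → ℚ
  ∣_∣ℚ = ℚ.∣_∣

  p≤∣p∣ : ∀ p → p ≤ ∣ p ∣ℚ
  p≤∣p∣ p with ℚ.≤-total 0ℚ p
  ... | inj₁ 0≤p = ℚ.≤-reflexive (sym (ℚ.0≤p⇒∣p∣≡p 0≤p))
  ... | inj₂ p≤0 = ℚ.≤-trans p≤0 (ℚ.0≤∣p∣ p)

  ∣p∣≤ : ∀ {p q} → p ≤ q → - p ≤ q → ∣ p ∣ℚ ≤ q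
  ∣p∣≤ {p} p≤q -p≤q with ℚ.∣p∣≡p∨∣p∣≡-p p
  ... | inj₁ eq = subst (_≤ _) (sym eq) p≤q
  ... | inj₂ eq = subst (_≤ _) (sym eq) -p≤q

  neg-minus : ∀ p q → - (p - q) ≡ q - p
  neg-minus = solve 2 (λ p q → :- (p :- q) := q :- p) refl
    where open +-*-Solver

  ∣p-q∣-comm : ∀ p q → ∣ p - q ∣ℚ ≡ ∣ q - p ∣ℚ
  ∣p-q∣-comm p q = trans (sym (ℚ.∣-p∣≡∣p∣ (p - q))) (cong ∣_∣ℚ (neg-minus p q))

  ∣p∣-∣q∣≤∣p-q∣ : ∀ p q → ∣ p ∣ℚ - ∣ q ∣ℚ ≤ ∣ p - q ∣ℚ
  ∣p∣-∣q∣≤∣p-q∣ p q = begin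
    ∣ p ∣ℚ - ∣ q ∣ℚ                   ≡⟨ cong (λ r → ∣ r ∣ℚ - ∣ q ∣ℚ) (split p q) ⟩
    ∣ p - q + q ∣ℚ - ∣ q ∣ℚ           ≤⟨ ℚ.+-monoˡ-≤ (- ∣ q ∣ℚ) (ℚ.∣p+q∣≤∣p∣+∣q∣ (p - q) q) ⟩
    ∣ p - q ∣ℚ + ∣ q ∣ℚ - ∣ q ∣ℚ      ≡⟨ cancel ∣ p - q ∣ℚ ∣ q ∣ℚ ⟩
    ∣ p - q ∣ℚ                        ∎
    where
    open ℚ.≤-Reasoning
    open +-*-Solver
    split : ∀ p q → p ≡ p - q + q
    split = solve 2 (λ p q → p := p :- q :+ q) refl
    cancel : ∀ p q → p + q - q ≡ p
    cancel = solve 2 (λ p q → p :+ q :- q := p) refl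

  ∣∣p∣-∣q∣∣≤∣p-q∣ : ∀ p q → ∣ ∣ p ∣ℚ - ∣ q ∣ℚ ∣ℚ ≤ ∣ p - q ∣ℚ
  ∣∣p∣-∣q∣∣≤∣p-q∣ p q = ∣p∣≤ (∣p∣-∣q∣≤∣p-q∣ p q)
    (subst₂ _≤_ (sym (neg-minus ∣ p ∣ℚ ∣ q ∣ℚ)) (∣p-q∣-comm q p) (∣p∣-∣q∣≤∣p-q∣ q p))

  ∣p*q∣≤ : ∀ {p q r s} → ∣ p ∣ℚ ≤ r → ∣ q ∣ℚ ≤ s → ∣ p * q ∣ℚ ≤ r * s
  ∣p*q∣≤ {p} {q} {r} {s} p≤r q≤s = begin
    ∣ p * q ∣ℚ          ≡⟨ ℚ.∣p*q∣≡∣p∣*∣q∣ p q ⟩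
    ∣ p ∣ℚ * ∣ q ∣ℚ     ≤⟨ ℚ.*-monoʳ-≤-nonNeg ∣ q ∣ℚ {{ℚ.∣-∣-nonNeg q}} p≤r ⟩
    r * ∣ q ∣ℚ          ≤⟨ ℚ.*-monoˡ-≤-nonNeg r {{nonNegative (ℚ.≤-trans (ℚ.0≤∣p∣ p) p≤r)}} q≤s ⟩
    r * s               ∎
    where open ℚ.≤-Reasoning

  within : ∀ {a b l d} → l ≤ a → a ≤ l + d → l ≤ b → b ≤ l + d → ∣ a - b ∣ℚ ≤ d
  within {a} {b} {l} {d} l≤a a≤l+d l≤b b≤l+d =
    ∣p∣≤ (half l≤b a≤l+d) (subst (_≤ d) (sym (neg-minus a b)) (half l≤a b≤l+d))
    where
    open +-*-Solver
    half : ∀ {a b} → l ≤ b → a ≤ l + d → a - b ≤ d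
    half l≤b a≤l+d = ℚ.≤-trans (ℚ.+-mono-≤ a≤l+d (ℚ.neg-antimono-≤ l≤b))
      (ℚ.≤-reflexive (solve 2 (λ l d → l :+ d :- l := d) refl l d))

  0<½* : ∀ {ε} → 0ℚ < ε → 0ℚ < ½ * ε
  0<½* = ℚ.*-monoʳ-<-pos ½

  p≤p+q : ∀ {p q} → 0ℚ ≤ q → p ≤ p + q
  p≤p+q {p} {q} 0≤q = subst (_≤ p + q) (ℚ.+-identityʳ p) (ℚ.+-monoʳ-≤ p 0≤q)

  ½+½ : ∀ ε → ½ * ε + ½ * ε ≡ ε
  ½+½ ε = trans (sym (ℚ.*-distribʳ-+ ε ½ ½)) (ℚ.*-identityˡ ε)

  0<* : ∀ {p q} → 0ℚ < p → 0ℚ < q → 0ℚ < p * q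
  0<* {p} {q} 0<p 0<q =
    ℚ.positive⁻¹ (p * q) {{ℚ.pos*pos⇒pos p {{positive 0<p}} q {{positive 0<q}}}}

  /-mono-≤ : ∀ m n a b .{{_ : NonZero a}} .{{_ : NonZero b}} →
             m ℕ.* b ℕ.≤ n ℕ.* a → + m / a ≤ + n / b
  /-mono-≤ m n (suc a) (suc b) le = ℚ.toℚᵘ-cancel-≤ (begin
    ℚ.toℚᵘ (+ m / suc a)    ≃⟨ ℚ.toℚᵘ-fromℚᵘ (ℚᵘ.mkℚᵘ (+ m) a) ⟩
    ℚᵘ.mkℚᵘ (+ m) a         ≤⟨ ℚᵘ.*≤* (subst₂ ℤ._≤_ (ℤ.pos-* m (suc b)) (ℤ.pos-* n (suc a)) (ℤ.+≤+ le)) ⟩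
    ℚᵘ.mkℚᵘ (+ n) b         ≃⟨ ℚ.toℚᵘ-fromℚᵘ (ℚᵘ.mkℚᵘ (+ n) b) ⟨
    ℚ.toℚᵘ (+ n / suc b)    ∎)
    where open ℚᵘ.≤-Reasoning

  1/↧≤ : ∀ {ε} → 0ℚ < ε → + 1 / (↧ₙ ε) ≤ ε
  1/↧≤ {mkℚ (+ zero) d c} (ℚ.*<* (ℤ.+<+ ()))
  1/↧≤ {ε@(mkℚ (+ suc p) d c)} 0<ε =
    subst (+ 1 / suc d ≤_) (ℚ.↥p/↧p≡p ε) (/-mono-≤ 1 (suc p) (suc d) (suc d) (ℕ.*-monoˡ-≤ (suc d) {1} {suc p} (ℕ.s≤s ℕ.z≤n)))
  1/↧≤ {mkℚ ℤ.-[1+ p ] d c} (ℚ.*<* ())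

record ℝ : Set where
  constructor mkℝ
  field
    seq    : ℕ → ℚ
    cauchy : ∀ ε → 0ℚ < ε → ∃ λ N → ∀ m n → N ℕ.≤ m → N ℕ.≤ n → ℚ.∣ seq m - seq n ∣ ≤ ε

open ℝ public

fromℚ : ℚ → ℝ
fromℚ q = mkℝ (λ _ → q) λ ε 0<ε → 0 , λ _ _ _ _ →
  subst (λ r → ℚ.∣ r ∣ ≤ ε) (sym (ℚ.+-inverseʳ q)) (ℚ.<⇒≤ 0<ε)

0ℝ 1ℝ 2ℝ : ℝ
0ℝ = fromℚ 0ℚ
1ℝ = fromℚ 1ℚ
2ℝ = fromℚ (+ 2 / 1)

infix 4 _<ℝ_ _#_

_<ℝ_ : ℝ → ℝ → Set
x <ℝ y = ∃ λ δ → 0ℚ < δ × ∃ λ N → ∀ n → N ℕ.≤ n → seq x n + δ ≤ seq y n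

-- Apartness, the constructive form of x ≠ y.
_#_ : ℝ → ℝ → Set
x # y = x <ℝ y ⊎ y <ℝ x

infixl 6 _-ℝ_
infixl 7 _*ℝ_

_-ℝ_ : ℝ → ℝ → ℝ
x -ℝ y = mkℝ (λ n → seq x n - seq y n) λ ε 0<ε →
  let (M , cx) = cauchy x (½ * ε) (0<½* 0<ε)
      (N , cy) = cauchy y (½ * ε) (0<½* 0<ε)
  in M ℕ.⊔ N , λ m n m≥ n≥ → begin
    ℚ.∣ (seq x m - seq y m) - (seq x n - seq y n) ∣
      ≡⟨ cong ∣_∣ℚ (rearrange (seq x m) (seq y m) (seq x n) (seq y n)) ⟩
    ℚ.∣ (seq x m - seq x n) - (seq y m - seq y n) ∣
      ≤⟨ ℚ.∣p-q∣≤∣p∣+∣q∣ (seq x m - seq x n) (seq y m - seq y n) ⟩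
    ℚ.∣ seq x m - seq x n ∣ + ℚ.∣ seq y m - seq y n ∣
      ≤⟨ ℚ.+-mono-≤ (cx m n (ℕ.m⊔n≤o⇒m≤o M N m≥) (ℕ.m⊔n≤o⇒m≤o M N n≥))
                    (cy m n (ℕ.m⊔n≤o⇒n≤o M N m≥) (ℕ.m⊔n≤o⇒n≤o M N n≥)) ⟩
    ½ * ε + ½ * ε
      ≡⟨ ½+½ ε ⟩
    ε ∎
  where
  open ℚ.≤-Reasoning
  open +-*-Solver
  rearrange : ∀ a b c d → (a - b) - (c - d) ≡ (a - c) - (b - d)
  rearrange = solve 4 (λ a b c d → (a :- b) :- (c :- d) := (a :- c) :- (b :- d)) refl

∣_∣ℝ : ℝ → ℝ
∣ x ∣ℝ = mkℝ (λ n → ℚ.∣ seq x n ∣) λ ε 0<ε →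
  let (N , c) = cauchy x ε 0<ε
  in N , λ m n m≥ n≥ → ℚ.≤-trans (∣∣p∣-∣q∣∣≤∣p-q∣ (seq x m) (seq x n)) (c m n m≥ n≥)

private
  bounded : ∀ x → ∃ λ M → 0ℚ < M × ∃ λ N → ∀ n → N ℕ.≤ n → ℚ.∣ seq x n ∣ ≤ M
  bounded x with cauchy x 1ℚ (ℚ.positive⁻¹ 1ℚ)
  ... | N , c = 1ℚ + ℚ.∣ seq x N ∣ , 0<M , N , λ n n≥ → begin
    ℚ.∣ seq x n ∣                              ≡⟨ cong ∣_∣ℚ (split (seq x n) (seq x N)) ⟩
    ℚ.∣ seq x n - seq x N + seq x N ∣          ≤⟨ ℚ.∣p+q∣≤∣p∣+∣q∣ (seq x n - seq x N) (seq x N) ⟩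
    ℚ.∣ seq x n - seq x N ∣ + ℚ.∣ seq x N ∣    ≤⟨ ℚ.+-monoˡ-≤ ℚ.∣ seq x N ∣ (c n N n≥ ℕ.≤-refl) ⟩
    1ℚ + ℚ.∣ seq x N ∣                         ∎
    where
    open ℚ.≤-Reasoning
    open +-*-Solver
    split : ∀ p q → p ≡ p - q + q
    split = solve 2 (λ p q → p := p :- q :+ q) refl
    0<M : 0ℚ < 1ℚ + ℚ.∣ seq x N ∣
    0<M = ℚ.+-mono-<-≤ (ℚ.positive⁻¹ 1ℚ) (ℚ.0≤∣p∣ (seq x N))

  *-estimate : ∀ a b c d {A B η} → ℚ.∣ a ∣ ≤ A → ℚ.∣ d ∣ ≤ B →
    ℚ.∣ a - c ∣ ≤ η → ℚ.∣ b - d ∣ ≤ η → ℚ.∣ a * b - c * d ∣ ≤ A * η + η * B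
  *-estimate a b c d {A} {B} {η} a≤ d≤ a-c≤ b-d≤ = begin
    ℚ.∣ a * b - c * d ∣                          ≡⟨ cong ∣_∣ℚ (expand a b c d) ⟩
    ℚ.∣ a * (b - d) + (a - c) * d ∣              ≤⟨ ℚ.∣p+q∣≤∣p∣+∣q∣ (a * (b - d)) ((a - c) * d) ⟩
    ℚ.∣ a * (b - d) ∣ + ℚ.∣ (a - c) * d ∣        ≤⟨ ℚ.+-mono-≤ (∣p*q∣≤ {a} {b - d} {A} {η} a≤ b-d≤) (∣p*q∣≤ {a - c} {d} {η} {B} a-c≤ d≤) ⟩
    A * η + η * B                                ∎
    where
    open ℚ.≤-Reasoning
    open +-*-Solver
    expand : ∀ a b c d → a * b - c * d ≡ a * (b - d) + (a - c) * d
    expand = solve 4 (λ a b c d → a :* b :- c :* d := a :* (b :- d) :+ (a :- c) :* d) refl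

  share : ∀ A B ε → 0ℚ < A → 0ℚ < B → 0ℚ < ε → ∃ λ η → 0ℚ < η × A * η + η * B ≡ ε
  share A B ε 0<A 0<B 0<ε = K⁻¹ * ε , 0<* (ℚ.positive⁻¹ K⁻¹ {{ℚ.1/pos⇒pos (A + B)}}) 0<ε , (begin
    A * (K⁻¹ * ε) + K⁻¹ * ε * B     ≡⟨ regroup A B K⁻¹ ε ⟩
    (A + B) * K⁻¹ * ε               ≡⟨ cong (_* ε) (ℚ.*-inverseʳ (A + B)) ⟩
    1ℚ * ε                          ≡⟨ ℚ.*-identityˡ ε ⟩
    ε                               ∎)
    where
    open ≡-Reasoning
    open +-*-Solver
    instance
      K-pos : ℚ.Positive (A + B)
      K-pos = positive (ℚ.+-mono-< 0<A 0<B)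
      K-nonZero : ℚ.NonZero (A + B)
      K-nonZero = ℚ.pos⇒nonZero (A + B)
    K⁻¹ : ℚ
    K⁻¹ = 1/ (A + B)
    regroup : ∀ a b k e → a * (k * e) + (k * e) * b ≡ (a + b) * k * e
    regroup = solve 4 (λ a b k e → a :* (k :* e) :+ (k :* e) :* b := (a :+ b) :* k :* e) refl

  BoundedBy : (ℕ → ℚ) → ℚ → ℕ → Set
  BoundedBy a M N = ∀ n → N ℕ.≤ n → ℚ.∣ a n ∣ ≤ M

  Near : (ℕ → ℚ) → ℚ → ℕ → Set
  Near a ε N = ∀ m n → N ℕ.≤ m → N ℕ.≤ n → ℚ.∣ a m - a n ∣ ≤ ε

  *-near : ∀ a b A B ε η Nᵃ Nᵇ N → A * η + η * B ≡ ε → BoundedBy a A Nᵃ → BoundedBy b B Nᵇ →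
    Near a η N → Near b η N → Near (λ n → a n * b n) ε ((Nᵃ ℕ.⊔ Nᵇ) ℕ.⊔ N)
  *-near a b A B ε η Nᵃ Nᵇ N eq a≤ b≤ near-a near-b m n m≥ n≥ =
    ℚ.≤-trans
      (*-estimate (a m) (b m) (a n) (b n)
        (a≤ m (ℕ.m⊔n≤o⇒m≤o Nᵃ Nᵇ (left m≥))) (b≤ n (ℕ.m⊔n≤o⇒n≤o Nᵃ Nᵇ (left n≥)))
        (near-a m n (right m≥) (right n≥)) (near-b m n (right m≥) (right n≥)))
      (ℚ.≤-reflexive eq)
    where
    left : ∀ {n} → (Nᵃ ℕ.⊔ Nᵇ) ℕ.⊔ N ℕ.≤ n → Nᵃ ℕ.⊔ Nᵇ ℕ.≤ n
    left = ℕ.m⊔n≤o⇒m≤o (Nᵃ ℕ.⊔ Nᵇ) N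
    right : ∀ {n} → (Nᵃ ℕ.⊔ Nᵇ) ℕ.⊔ N ℕ.≤ n → N ℕ.≤ n
    right = ℕ.m⊔n≤o⇒n≤o (Nᵃ ℕ.⊔ Nᵇ) N

  near-mono : ∀ a ε {M N} → M ℕ.≤ N → Near a ε M → Near a ε N
  near-mono a ε M≤N near m n m≥ n≥ = near m n (ℕ.≤-trans M≤N m≥) (ℕ.≤-trans M≤N n≥)

  *-cauchy : ∀ x y ε → 0ℚ < ε → ∃ (Near (λ n → seq x n * seq y n) ε)
  *-cauchy x y ε 0<ε = step₁ (bounded x) (bounded y)
    where
    step₂ : ∀ A B η Nᵃ Nᵇ → A * η + η * B ≡ ε → BoundedBy (seq x) A Nᵃ → BoundedBy (seq y) B Nᵇ →
      ∃ (Near (seq x) η) → ∃ (Near (seq y) η) → ∃ (Near (λ n → seq x n * seq y n) ε)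
    step₂ A B η Nᵃ Nᵇ eq bx by (Nˣ , cx) (Nʸ , cy) =
      (Nᵃ ℕ.⊔ Nᵇ) ℕ.⊔ (Nˣ ℕ.⊔ Nʸ) ,
      *-near (seq x) (seq y) A B ε η Nᵃ Nᵇ (Nˣ ℕ.⊔ Nʸ) eq bx by
        (near-mono (seq x) η (ℕ.m≤m⊔n Nˣ Nʸ) cx) (near-mono (seq y) η (ℕ.m≤n⊔m Nˣ Nʸ) cy)
    step₁ : (∃ λ A → 0ℚ < A × ∃ (BoundedBy (seq x) A)) → (∃ λ B → 0ℚ < B × ∃ (BoundedBy (seq y) B)) →
      ∃ (Near (λ n → seq x n * seq y n) ε)
    step₁ (A , 0<A , Nᵃ , bx) (B , 0<B , Nᵇ , by) =
      let (η , 0<η , eq) = share A B ε 0<A 0<B 0<ε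
      in step₂ A B η Nᵃ Nᵇ eq bx by (cauchy x η 0<η) (cauchy y η 0<η)

_*ℝ_ : ℝ → ℝ → ℝ
x *ℝ y = mkℝ (λ n → seq x n * seq y n) (*-cauchy x y)

-- Only finitely many terms of a sequence apart from 0 can vanish, so the
-- value of recip at 0 is irrelevant in _⁻¹⟨_⟩.
recip : ℚ → ℚ
recip q with q ℚ.≟ 0ℚ
... | yes _  = 0ℚ
... | no q≢0 = (1/ q) {{≢-nonZero q≢0}}

private
  recip-* : ∀ q → q ≢ 0ℚ → recip q * q ≡ 1ℚ
  recip-* q q≢0 with q ℚ.≟ 0ℚ
  ... | yes q≡0 = contradiction q≡0 q≢0
  ... | no q≢0′ = ℚ.*-inverseˡ q {{≢-nonZero q≢0′}}

  AwayFrom0 : ℝ → Set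
  AwayFrom0 x = ∃ λ δ → 0ℚ < δ × ∃ λ N → ∀ n → N ℕ.≤ n → δ ≤ ℚ.∣ seq x n ∣

  #0⇒away : ∀ x → x # 0ℝ → AwayFrom0 x
  #0⇒away x (inj₁ (δ , 0<δ , N , x+δ≤0)) = δ , 0<δ , N , λ n n≥ → begin
    δ                      ≡⟨ solve 2 (λ a d → d := (a :+ d) :- a) refl (seq x n) δ ⟩
    (seq x n + δ) - seq x n  ≤⟨ ℚ.+-monoˡ-≤ (- seq x n) (x+δ≤0 n n≥) ⟩
    0ℚ - seq x n           ≡⟨ ℚ.+-identityˡ (- seq x n) ⟩
    - seq x n              ≤⟨ p≤∣p∣ (- seq x n) ⟩
    ℚ.∣ - seq x n ∣        ≡⟨ ℚ.∣-p∣≡∣p∣ (seq x n) ⟩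
    ℚ.∣ seq x n ∣          ∎
    where
    open ℚ.≤-Reasoning
    open +-*-Solver
  #0⇒away x (inj₂ (δ , 0<δ , N , 0+δ≤x)) = δ , 0<δ , N , λ n n≥ →
    ℚ.≤-trans (subst (_≤ seq x n) (ℚ.+-identityˡ δ) (0+δ≤x n n≥)) (p≤∣p∣ (seq x n))

private
  module Away {δ} (0<δ : 0ℚ < δ) where
    open +-*-Solver
    instance
      δ-pos : ℚ.Positive δ
      δ-pos = positive 0<δ
      δ-nonZero : ℚ.NonZero δ
      δ-nonZero = ℚ.pos⇒nonZero δ
    δ⁻¹ : ℚ
    δ⁻¹ = 1/ δ

    ≢0 : ∀ a → δ ≤ ℚ.∣ a ∣ → a ≢ 0ℚ
    ≢0 a δ≤ eq = ℚ.<-irrefl refl (ℚ.<-≤-trans 0<δ (subst (λ q → δ ≤ ℚ.∣ q ∣) eq δ≤))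

    recip≤ : ∀ a → δ ≤ ℚ.∣ a ∣ → ℚ.∣ recip a ∣ ≤ δ⁻¹
    recip≤ a δ≤ = ℚ.*-cancelʳ-≤-pos δ (begin
      ℚ.∣ recip a ∣ * δ          ≤⟨ ℚ.*-monoˡ-≤-nonNeg ℚ.∣ recip a ∣ {{ℚ.∣-∣-nonNeg (recip a)}} δ≤ ⟩
      ℚ.∣ recip a ∣ * ℚ.∣ a ∣    ≡⟨ ℚ.∣p*q∣≡∣p∣*∣q∣ (recip a) a ⟨
      ℚ.∣ recip a * a ∣          ≡⟨ cong ∣_∣ℚ (recip-* a (≢0 a δ≤)) ⟩
      1ℚ                         ≡⟨ ℚ.*-inverseˡ δ ⟨
      δ⁻¹ * δ                    ∎)
      where open ℚ.≤-Reasoning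

    difference : ∀ a b → a ≢ 0ℚ → b ≢ 0ℚ → recip a - recip b ≡ (b - a) * (recip a * recip b)
    difference a b a≢0 b≢0 = begin
      recip a - recip b
        ≡⟨ cong₂ _-_ (ℚ.*-identityʳ (recip a)) (ℚ.*-identityʳ (recip b)) ⟨
      recip a * 1ℚ - recip b * 1ℚ
        ≡⟨ cong₂ (λ u v → recip a * u - recip b * v) (recip-* b b≢0) (recip-* a a≢0) ⟨
      recip a * (recip b * b) - recip b * (recip a * a)
        ≡⟨ rearrange a b (recip a) (recip b) ⟩
      (b - a) * (recip a * recip b) ∎
      where
      open ≡-Reasoning
      rearrange : ∀ a b r s → r * (s * b) - s * (r * a) ≡ (b - a) * (r * s)
      rearrange = solve 4 (λ a b r s → r :* (s :* b) :- s :* (r :* a) := (b :- a) :* (r :* s)) refl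

    inverse-estimate : ∀ a b ε → δ ≤ ℚ.∣ a ∣ → δ ≤ ℚ.∣ b ∣ → ℚ.∣ b - a ∣ ≤ ε * (δ * δ) →
      ℚ.∣ recip a - recip b ∣ ≤ ε
    inverse-estimate a b ε δ≤a δ≤b b-a≤ = begin
      ℚ.∣ recip a - recip b ∣
        ≡⟨ cong ∣_∣ℚ (difference a b (≢0 a δ≤a) (≢0 b δ≤b)) ⟩
      ℚ.∣ (b - a) * (recip a * recip b) ∣
        ≤⟨ ∣p*q∣≤ {b - a} {recip a * recip b} {ε * (δ * δ)} {δ⁻¹ * δ⁻¹} b-a≤
             (∣p*q∣≤ {recip a} {recip b} {δ⁻¹} {δ⁻¹} (recip≤ a δ≤a) (recip≤ b δ≤b)) ⟩
      ε * (δ * δ) * (δ⁻¹ * δ⁻¹)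
        ≡⟨ regroup ε δ δ⁻¹ ⟩
      ε * ((δ * δ⁻¹) * (δ * δ⁻¹))
        ≡⟨ cong (λ u → ε * (u * u)) (ℚ.*-inverseʳ δ) ⟩
      ε * 1ℚ
        ≡⟨ ℚ.*-identityʳ ε ⟩
      ε ∎
      where
      open ℚ.≤-Reasoning
      regroup : ∀ e d r → e * (d * d) * (r * r) ≡ e * ((d * r) * (d * r))
      regroup = solve 3 (λ e d r → e :* (d :* d) :* (r :* r) := e :* ((d :* r) :* (d :* r))) refl

_⁻¹⟨_⟩ : (x : ℝ) → x # 0ℝ → ℝ
x ⁻¹⟨ x#0 ⟩ = mkℝ (λ n → recip (seq x n)) λ ε 0<ε → inverse-cauchy ε 0<ε (#0⇒away x x#0)
  where
  inverse-cauchy : ∀ ε → 0ℚ < ε → AwayFrom0 x → ∃ λ N → ∀ m n → N ℕ.≤ m → N ℕ.≤ n →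
    ℚ.∣ recip (seq x m) - recip (seq x n) ∣ ≤ ε
  inverse-cauchy ε 0<ε (δ , 0<δ , M , δ≤) with cauchy x (ε * (δ * δ)) (0<* 0<ε (0<* 0<δ 0<δ))
  ... | N , c = M ℕ.⊔ N , λ m n m≥ n≥ →
    Away.inverse-estimate 0<δ (seq x m) (seq x n) ε
      (δ≤ m (ℕ.m⊔n≤o⇒m≤o M N m≥)) (δ≤ n (ℕ.m⊔n≤o⇒m≤o M N n≥))
      (c n m (ℕ.m⊔n≤o⇒n≤o M N n≥) (ℕ.m⊔n≤o⇒n≤o M N m≥))

infixl 7 _÷ℝ_⟨_⟩

_÷ℝ_⟨_⟩ : (x y : ℝ) → y # 0ℝ → ℝ
x ÷ℝ y ⟨ y#0 ⟩ = x *ℝ (y ⁻¹⟨ y#0 ⟩)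

Sequence : Set
Sequence = (n : ℕ) → .{{NonZero n}} → ℝ

infix 4 _⟶_ _∼_

_⟶_ : Sequence → ℝ → Set
a ⟶ L = ∀ ε → 0ℝ <ℝ ε → ∃ λ N → ∀ n → .{{_ : NonZero n}} → N ℕ.≤ n → ∣ a n -ℝ L ∣ℝ <ℝ ε

-- Asymptotic equivalence: a n / b n ⟶ 1, with b n nonzero for every n ≥ 1.
_∼_ : Sequence → Sequence → Set
a ∼ b = Σ (∀ n → .{{_ : NonZero n}} → b n # 0ℝ) λ b#0 →
  (λ n → a n ÷ℝ b n ⟨ b#0 n ⟩) ⟶ 1ℝ

inv! : ℕ → ℚ
inv! k = (+ 1 / k !) {{k ℕ.!≢0}}

expSum : ℕ → ℚ
expSum zero    = inv! 0
expSum (suc n) = expSum n + inv! (suc n)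

private
  0≤inv! : ∀ k → 0ℚ ≤ inv! k
  0≤inv! k = /-mono-≤ 0 1 1 (k !) {{_}} {{k ℕ.!≢0}} ℕ.z≤n

  half-≤ : ∀ c d .{{_ : NonZero c}} .{{_ : NonZero d}} → 2 ℕ.* c ℕ.≤ d →
           + 1 / d + + 1 / d ≤ + 1 / c
  half-≤ (suc c) (suc d) 2c≤d = ℚ.toℚᵘ-cancel-≤ (begin
    ℚ.toℚᵘ (+ 1 / suc d + + 1 / suc d)              ≃⟨ ℚ.toℚᵘ-homo-+ (+ 1 / suc d) (+ 1 / suc d) ⟩
    ℚ.toℚᵘ (+ 1 / suc d) ℚᵘ.+ ℚ.toℚᵘ (+ 1 / suc d)  ≃⟨ ℚᵘ.+-cong (ℚ.toℚᵘ-fromℚᵘ 1/d) (ℚ.toℚᵘ-fromℚᵘ 1/d) ⟩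
    1/d ℚᵘ.+ 1/d                                    ≤⟨ ℚᵘ.*≤* (ℤ.+≤+ le) ⟩
    ℚᵘ.mkℚᵘ (+ 1) c                                 ≃⟨ ℚ.toℚᵘ-fromℚᵘ (ℚᵘ.mkℚᵘ (+ 1) c) ⟨
    ℚ.toℚᵘ (+ 1 / suc c)                            ∎)
    where
    open ℚᵘ.≤-Reasoning
    1/d = ℚᵘ.mkℚᵘ (+ 1) d
    arith : ∀ c d → (1 ℕ.* d ℕ.+ 1 ℕ.* d) ℕ.* c ≡ (2 ℕ.* c) ℕ.* d
    arith = ℕ-Solver.solve-∀
    le : (1 ℕ.* suc d ℕ.+ 1 ℕ.* suc d) ℕ.* suc c ℕ.≤ 1 ℕ.* (suc d ℕ.* suc d)
    le = ℕ.≤-trans (ℕ.≤-reflexive (arith (suc c) (suc d)))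
           (ℕ.≤-trans (ℕ.*-monoˡ-≤ (suc d) 2c≤d) (ℕ.≤-reflexive (sym (ℕ.*-identityˡ _))))

  halve : ∀ k → 1 ℕ.≤ k → inv! (suc k) + inv! (suc k) ≤ inv! k
  halve k 1≤k = half-≤ (k !) (suc k !) {{k ℕ.!≢0}} {{suc k ℕ.!≢0}} (ℕ.*-monoˡ-≤ (k !) (ℕ.s≤s 1≤k))

  expSum-mono : ∀ m j → expSum m ≤ expSum (j ℕ.+ m)
  expSum-mono m zero    = ℚ.≤-refl
  expSum-mono m (suc j) = ℚ.≤-trans (expSum-mono m j)
    (p≤p+q (0≤inv! (suc j ℕ.+ m)))

  expSum-upper : ∀ m j → 1 ℕ.≤ m → expSum (j ℕ.+ m) + inv! (j ℕ.+ m) ≤ expSum m + inv! m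
  expSum-upper m zero    1≤m = ℚ.≤-refl
  expSum-upper m (suc j) 1≤m = begin
    expSum (j ℕ.+ m) + inv! (suc (j ℕ.+ m)) + inv! (suc (j ℕ.+ m))
      ≡⟨ ℚ.+-assoc (expSum (j ℕ.+ m)) (inv! (suc (j ℕ.+ m))) (inv! (suc (j ℕ.+ m))) ⟩
    expSum (j ℕ.+ m) + (inv! (suc (j ℕ.+ m)) + inv! (suc (j ℕ.+ m)))
      ≤⟨ ℚ.+-monoʳ-≤ (expSum (j ℕ.+ m)) (halve (j ℕ.+ m) (ℕ.≤-trans 1≤m (ℕ.m≤n+m m j))) ⟩
    expSum (j ℕ.+ m) + inv! (j ℕ.+ m)
      ≤⟨ expSum-upper m j 1≤m ⟩
    expSum m + inv! m ∎
    where open ℚ.≤-Reasoning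

  expSum-≤ : ∀ m j → 1 ℕ.≤ m → expSum (j ℕ.+ m) ≤ expSum m + inv! m
  expSum-≤ m j 1≤m = ℚ.≤-trans
    (p≤p+q (0≤inv! (j ℕ.+ m))) (expSum-upper m j 1≤m)

  n≤n! : ∀ n → n ℕ.≤ n !
  n≤n! zero    = ℕ.z≤n
  n≤n! (suc n) = ℕ.m≤m*n (suc n) (n !) {{n ℕ.!≢0}}

  inv!-↧≤ : ∀ {ε} → 0ℚ < ε → inv! (↧ₙ ε) ≤ ε
  inv!-↧≤ {ε} 0<ε = ℚ.≤-trans
    (/-mono-≤ 1 1 (↧ₙ ε !) (↧ₙ ε) {{↧ₙ ε ℕ.!≢0}} (ℕ.*-monoʳ-≤ 1 (n≤n! (↧ₙ ε))))
    (1/↧≤ 0<ε)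

e : ℝ
e = mkℝ expSum λ ε 0<ε → ↧ₙ ε , λ m n m≥ n≥ →
  ℚ.≤-trans (within (lower m≥) (upper m≥) (lower n≥) (upper n≥)) (inv!-↧≤ 0<ε)
  where
  lower : ∀ {N n} → N ℕ.≤ n → expSum N ≤ expSum n
  lower {N} {n} N≤n = subst (λ k → expSum N ≤ expSum k) (ℕ.m∸n+n≡m N≤n) (expSum-mono N (n ℕ.∸ N))
  upper : ∀ {N n} .{{_ : NonZero N}} → N ℕ.≤ n → expSum n ≤ expSum N + inv! N
  upper {N} {n} N≤n = subst (λ k → expSum k ≤ expSum N + inv! N) (ℕ.m∸n+n≡m N≤n)
    (expSum-≤ N (n ℕ.∸ N) (ℕ.>-nonZero⁻¹ N))

e² : ℝ
e² = e *ℝ e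

e²#0 : e² # 0ℝ
e²#0 = inj₂ (1ℚ , ℚ.positive⁻¹ 1ℚ , 0 , λ n _ → 1≤sq n)
  where
  open ℚ.≤-Reasoning
  1≤ : ∀ n → 1ℚ ≤ expSum n
  1≤ n = subst (λ k → 1ℚ ≤ expSum k) (ℕ.+-identityʳ n) (expSum-mono 0 n)
  1≤sq : ∀ n → 0ℚ + 1ℚ ≤ expSum n * expSum n
  1≤sq n = begin
    1ℚ                     ≤⟨ 1≤ n ⟩
    expSum n               ≡⟨ ℚ.*-identityˡ (expSum n) ⟨
    1ℚ * expSum n          ≤⟨ ℚ.*-monoʳ-≤-nonNeg (expSum n) {{nonNegative (ℚ.≤-trans (ℚ.nonNegative⁻¹ 1ℚ) (1≤ n))}} (1≤ n) ⟩
    expSum n * expSum n    ∎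

allSubsets : ∀ m → List (Subset m)
allSubsets zero    = [ [] ]
allSubsets (suc m) = map (outside ∷_) (allSubsets m) ++ map (inside ∷_) (allSubsets m)

∈-allSubsets : ∀ {m} (p : Subset m) → p ∈ˡ allSubsets m
∈-allSubsets []                          = here refl
∈-allSubsets {suc m} (outside ∷ p)       = ∈-++⁺ˡ (∈-map⁺ (outside ∷_) (∈-allSubsets p))
∈-allSubsets {suc m} (inside ∷ p)        = ∈-++⁺ʳ (map (outside ∷_) (allSubsets m)) (∈-map⁺ (inside ∷_) (∈-allSubsets p))

subsetsOfSize : ∀ m → ℕ → List (Subset m)
subsetsOfSize m k = filter (λ p → ∣ p ∣ ℕ.≟ k) (allSubsets m)

private
  filter-outside : ∀ {m} k (ps : List (Subset m)) →
    length (filter (λ p → ∣ p ∣ ℕ.≟ k) (map (outside ∷_) ps)) ≡ length (filter (λ p → ∣ p ∣ ℕ.≟ k) ps)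
  filter-outside k []       = refl
  filter-outside k (p ∷ ps) with ∣ p ∣ ℕ.≡ᵇ k
  ... | true  = cong suc (filter-outside k ps)
  ... | false = filter-outside k ps

  filter-inside-suc : ∀ {m} k (ps : List (Subset m)) →
    length (filter (λ p → ∣ p ∣ ℕ.≟ suc k) (map (inside ∷_) ps)) ≡ length (filter (λ p → ∣ p ∣ ℕ.≟ k) ps)
  filter-inside-suc k []       = refl
  filter-inside-suc k (p ∷ ps) with ∣ p ∣ ℕ.≡ᵇ k
  ... | true  = cong suc (filter-inside-suc k ps)
  ... | false = filter-inside-suc k ps

  filter-inside-zero : ∀ {m} (ps : List (Subset m)) →
    length (filter (λ p → ∣ p ∣ ℕ.≟ 0) (map (inside ∷_) ps)) ≡ 0
  filter-inside-zero []       = refl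
  filter-inside-zero (p ∷ ps) = filter-inside-zero ps

  length-subsets-suc : ∀ m k → length (subsetsOfSize (suc m) k) ≡
    length (subsetsOfSize m k) ℕ.+ length (filter (λ p → ∣ p ∣ ℕ.≟ k) (map (inside ∷_) (allSubsets m)))
  length-subsets-suc m k = begin
    length (filter P? (map (outside ∷_) (allSubsets m) ++ map (inside ∷_) (allSubsets m)))
      ≡⟨ cong length (filter-++ P? (map (outside ∷_) (allSubsets m)) (map (inside ∷_) (allSubsets m))) ⟩
    length (filter P? (map (outside ∷_) (allSubsets m)) ++ filter P? (map (inside ∷_) (allSubsets m)))
      ≡⟨ length-++ (filter P? (map (outside ∷_) (allSubsets m))) ⟩
    length (filter P? (map (outside ∷_) (allSubsets m))) ℕ.+ length (filter P? (map (inside ∷_) (allSubsets m)))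
      ≡⟨ cong (ℕ._+ length (filter P? (map (inside ∷_) (allSubsets m)))) (filter-outside k (allSubsets m)) ⟩
    length (subsetsOfSize m k) ℕ.+ length (filter P? (map (inside ∷_) (allSubsets m))) ∎
    where
    open ≡-Reasoning
    P? : Decidable {A = Subset (suc m)} (λ p → ∣ p ∣ ≡ k)
    P? p = ∣ p ∣ ℕ.≟ k

length-subsetsOfSize : ∀ m k → length (subsetsOfSize m k) ≡ m C k
length-subsetsOfSize zero    zero    = refl
length-subsetsOfSize zero    (suc k) = refl
length-subsetsOfSize (suc m) zero    = begin
  length (subsetsOfSize (suc m) 0)   ≡⟨ length-subsets-suc m 0 ⟩
  _                                  ≡⟨ cong₂ ℕ._+_ (length-subsetsOfSize m 0) (filter-inside-zero (allSubsets m)) ⟩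
  m C 0 ℕ.+ 0                        ≡⟨ ℕ.+-identityʳ (m C 0) ⟩
  m C 0                              ≡⟨ trans (nC0≡1 m) (sym (nC0≡1 (suc m))) ⟩
  suc m C 0                          ∎
  where
  open ≡-Reasoning
  nC0≡1 : ∀ n → n C 0 ≡ 1
  nC0≡1 n = trans (nCk≡nC[n∸k] {0} {n} ℕ.z≤n) (nCn≡1 n)
length-subsetsOfSize (suc m) (suc k) = begin
  length (subsetsOfSize (suc m) (suc k))  ≡⟨ length-subsets-suc m (suc k) ⟩
  _                                       ≡⟨ cong₂ ℕ._+_ (length-subsetsOfSize m (suc k)) (trans (filter-inside-suc k (allSubsets m)) (length-subsetsOfSize m k)) ⟩
  m C suc k ℕ.+ m C k                     ≡⟨ ℕ.+-comm (m C suc k) (m C k) ⟩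
  m C k ℕ.+ m C suc k                     ≡⟨ nCk+nC[k+1]≡[n+1]C[k+1] m k ⟩
  suc m C suc k                           ∎
  where open ≡-Reasoning

-- A uniform expectation only when xs has no repetitions; for subsetsOfSize this
-- follows from ∈-allSubsets together with length-subsetsOfSize.
uniformMean : ∀ {A : Set} (f : A → ℕ) (xs : List A) → .{{NonZero (length xs)}} → ℚ
uniformMean f xs = + sum (map f xs) / length xs

module _ (n : ℕ) where

  -- Coordinates run over 0, …, n - 1 instead of 1, …, n; attacks depend only
  -- on coordinate differences.
  Space : Set
  Space = Fin n × Fin n

  -- combine is a bijection Fin n × Fin n → Fin (n * n).
  Board : Set
  Board = Subset (n ℕ.* n)

  Occupied : Board → Space → Set
  Occupied B (i , j) = combine i j ∈ B

  BishopAttacks : Space → Space → Set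
  BishopAttacks (i , j) (x , y) = ℕ.∣ toℕ x - toℕ i ∣ ≡ ℕ.∣ toℕ y - toℕ j ∣

  Safe : Board → Space → Set
  Safe B s = ¬ Occupied B s × (∀ i j → Occupied B (i , j) → ¬ BishopAttacks (i , j) s)

  occupied? : ∀ B → Decidable (Occupied B)
  occupied? B (i , j) = combine i j ∈? B

  bishopAttacks? : ∀ p s → Dec (BishopAttacks p s)
  bishopAttacks? (i , j) (x , y) = ℕ.∣ toℕ x - toℕ i ∣ ℕ.≟ ℕ.∣ toℕ y - toℕ j ∣

  safe? : ∀ B → Decidable (Safe B)
  safe? B s = ¬? (occupied? B s) ×-dec
    all? (λ i → all? (λ j → occupied? B (i , j) →-dec ¬? (bishopAttacks? (i , j) s)))

  safeCount : Board → ℕ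
  safeCount B = length (filter (safe? B) (cartesianProduct (allFin n) (allFin n)))

  configurations : List Board
  configurations = subsetsOfSize (n ℕ.* n) n

configurations-nonEmpty : ∀ n → NonZero (length (configurations n))
configurations-nonEmpty n = subst NonZero (sym (length-subsetsOfSize (n ℕ.* n) n)) (C-nonZero (n≤n*n n))
  where
  n≤n*n : ∀ n → n ℕ.≤ n ℕ.* n
  n≤n*n zero    = ℕ.z≤n
  n≤n*n (suc n) = ℕ.m≤m*n (suc n) (suc n)
  C-nonZero : ∀ {m k} → k ℕ.≤ m → NonZero (m C k)
  C-nonZero {m} {k} k≤m = subst NonZero (sym (nCk≡n!/k![n-k]! k≤m))
    (ℕ.>-nonZero (m≥n⇒m/n>0 {m !} {k ! ℕ.* (m ℕ.∸ k) !} {{k ℕ.!* (m ℕ.∸ k) !≢0}} (∣⇒≤ {{m ℕ.!≢0}} (k![n∸k]!∣n! k≤m))))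

expectedSafe : ℕ → ℚ
expectedSafe n = uniformMean (safeCount n) (configurations n) {{configurations-nonEmpty n}}

μ : (n : ℕ) → .{{NonZero n}} → ℚ
μ n = expectedSafe n * (+ 1 / (n ℕ.* n)) {{ℕ.m*n≢0 n n}}

module Submission where

-- A space (x , y) is safe exactly when all bishops avoid the a = n + 2r spaces on
-- its two diagonals, r being its distance from the border, so E[S_n] is the sum
-- over the spaces of C(n² - a, n) / C(n², n). Up to an error O(n) the sum over the
-- rings of the board is 2 Σ_{i < n} (n - 1 - i) C(n² - n - i, n) / C(n², n), which
-- the hockey-stick identity evaluates in closed form; up to O(n) it equals
-- 2 C(n² - 2n + 2, n + 2) / C(n², n). Comparing factors, this lies
-- between 2 n² (1 - 1/(n-2))^(2n) (1 - O(1/n)) and 2 n² (1 - 1/n)^(2n). Finally the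
-- partial sums s_k of the exponential series satisfy
-- (1 + 1/m)^m ≤ s_k ≤ (1 + 1/(m-1))^m for k ≥ m, whence |μ_n s_k² - 2| = O(1/n)
-- for k ≥ n.

open import Data.Bool using (Bool; true; false; if_then_else_)
open import Data.Fin using (Fin; toℕ; combine)
open import Data.Fin.Properties using (combine-remQuot; toℕ<n)
open import Data.Fin.Subset using (Subset; inside; outside; ∁; _⊆_; ∣_∣) renaming (_∈_ to _∈ˢ_)
open import Data.Fin.Subset.Properties using (_⊆?_; ∣∁p∣≡n∸∣p∣; x∉p⇒x∈∁p; x∈p⇒x∉∁p)
import Data.Integer as ℤ
import Data.Integer.Properties as ℤ
open import Data.List using (List; []; _∷_; _++_; map; filter; length; tabulate; allFin; cartesianProduct)
open import Data.List.Properties using (map-++; map-∘; map-cong; map-tabulate; filter-++; filter-≐; length-++)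
open import Data.Nat using (ℕ; zero; suc; _+_; _*_; _∸_; _^_; _!; _≤_; _<_; z≤n; s≤s; _⊓_; _⊔_; _≟_; ∣_-_∣; _≡ᵇ_; NonZero; >-nonZero⁻¹)
open import Data.Nat.Combinatorics using (_C_; nCk+nC[k+1]≡[n+1]C[k+1])
open import Data.Nat.ListAction using (sum)
open import Data.Nat.ListAction.Properties using (sum-++)
open import Data.Nat.Properties
open import Data.Nat.Tactic.RingSolver using (solve-∀)
open import Data.Product using (∃; _×_; _,_; proj₁; proj₂)
open import Data.Rational using (ℚ; mkℚ; 0ℚ; 1ℚ; ½; _/_; positive; nonNegative)
  renaming (_+_ to _+ℚ_; _*_ to _*ℚ_; _-_ to _-ℚ_; -_ to -ℚ_; _≤_ to _≤ℚ_; _<_ to _<ℚ_; ∣_∣ to ∣_∣ℚ)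
import Data.Rational as ℚ
open import Data.Rational.Literals using (fromℤ)
import Data.Rational.Properties as ℚ
open import Data.Rational.Solver using (module +-*-Solver)
import Data.Rational.Unnormalised as ℚᵘ
import Data.Rational.Unnormalised.Properties as ℚᵘ
open import Data.Sum using (inj₁; inj₂)
open import Data.Vec as Vec using (Vec)
import Data.Vec.Properties as Vec
open import Function using (_∘_; id; _⇔_; mk⇔; Equivalence)
open import Relation.Binary.PropositionalEquality
open import Relation.Nullary using (Dec; does; yes; no; ¬_; contradiction)
open import Relation.Nullary.Decidable using (dec-true)
open import Relation.Unary using (Decidable)
open import Defs
open +-*-Solver using (solve; _:=_; _:+_; _:*_; _:-_; :-_; con)

-- Why 2/e²: a space of ring r avoids all bishops with probability about e^(-(1+u)), where u = 2r/n,
-- so the ring sum is about 2n² times the integral of (1 - u) e^(-(1+u)) over 0 ≤ u ≤ 1. Integration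
-- by parts gives e^(-1) - (e^(-1) - e^(-2)): two terms of the order of the answer cancel. The
-- hockey-stick identity is the discrete form of this computation; the cancelling terms become n
-- C(n² - n + 1, n + 1) and C(n² - n + 2, n + 2), and their difference has to be bounded separately.
-- A real is a Cauchy sequence of rationals, and the k-th term of e² is s_k². Hence no property of e
-- itself is used: both limits reduce to one rational bound on μ_n s_k² - 2, uniform in k ≥ n.
-- Errors are measured in units of n C(n², n), of which the total number of safe spaces contains
-- about 2n/e².

⟦_⟧ : Bool → ℕ
⟦ b ⟧ = if b then 1 else 0

-- Finite sums and double counting

∑ : ℕ → (ℕ → ℕ) → ℕ
∑ zero    f = 0
∑ (suc n) f = f 0 + ∑ n (f ∘ suc)

∑-cong : ∀ n {f g : ℕ → ℕ} → (∀ {i} → i < n → f i ≡ g i) → ∑ n f ≡ ∑ n g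
∑-cong zero    f≗g = refl
∑-cong (suc n) f≗g = cong₂ _+_ (f≗g (s≤s z≤n)) (∑-cong n λ i<n → f≗g (s≤s i<n))

∑-last : ∀ n f → ∑ (suc n) f ≡ ∑ n f + f n
∑-last zero    f = +-comm (f 0) 0
∑-last (suc n) f = trans (cong (f 0 +_) (∑-last n (f ∘ suc))) (sym (+-assoc (f 0) _ _))

∑-const : ∀ n c → ∑ n (λ _ → c) ≡ n * c
∑-const zero    c = refl
∑-const (suc n) c = cong (c +_) (∑-const n c)

∑-distrib-+ : ∀ n f g → ∑ n (λ i → f i + g i) ≡ ∑ n f + ∑ n g
∑-distrib-+ zero    f g = refl
∑-distrib-+ (suc n) f g = trans (cong (f 0 + g 0 +_) (∑-distrib-+ n (f ∘ suc) (g ∘ suc)))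
  (interchange (f 0) (g 0) (∑ n (f ∘ suc)) (∑ n (g ∘ suc)))
  where
  interchange : ∀ a b c d → a + b + (c + d) ≡ a + c + (b + d)
  interchange = solve-∀

∑-zero : ∀ n {f : ℕ → ℕ} → (∀ {i} → i < n → f i ≡ 0) → ∑ n f ≡ 0
∑-zero n f≡0 = trans (∑-cong n f≡0) (trans (∑-const n 0) (*-zeroʳ n))

sum-allFin : ∀ n (h : ℕ → ℕ) → sum (map (h ∘ toℕ) (allFin n)) ≡ ∑ n h
sum-allFin n h = trans (cong sum (map-tabulate {n = n} id (h ∘ toℕ))) (sum-tabulate n h)
  where
  sum-tabulate : ∀ n (h : ℕ → ℕ) → sum (tabulate {n = n} (h ∘ toℕ)) ≡ ∑ n h
  sum-tabulate zero    h = refl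
  sum-tabulate (suc n) h = cong (h 0 +_) (sum-tabulate n (h ∘ suc))

sum-cartesianProduct : ∀ {A B : Set} (f : A × B → ℕ) xs ys →
  sum (map f (cartesianProduct xs ys)) ≡ sum (map (λ x → sum (map (λ y → f (x , y)) ys)) xs)
sum-cartesianProduct f []       ys = refl
sum-cartesianProduct f (x ∷ xs) ys = begin
  sum (map f (map (x ,_) ys ++ cartesianProduct xs ys))
    ≡⟨ cong sum (map-++ f (map (x ,_) ys) _) ⟩
  sum (map f (map (x ,_) ys) ++ map f (cartesianProduct xs ys))
    ≡⟨ sum-++ (map f (map (x ,_) ys)) _ ⟩
  sum (map f (map (x ,_) ys)) + sum (map f (cartesianProduct xs ys))
    ≡⟨ cong₂ _+_ (cong sum (sym (map-∘ ys))) (sum-cartesianProduct f xs ys) ⟩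
  _ ∎
  where open ≡-Reasoning

-- Double counting of the related pairs, one row at a time. This is linearity of expectation: the
-- safe spaces of all boards are counted by the boards for which a given space is safe.
sum-filter-swap : ∀ {A B : Set} {R : A → B → Set} (R? : ∀ a b → Dec (R a b)) xs ys →
  sum (map (λ x → length (filter (R? x) ys)) xs) ≡
  sum (map (λ y → length (filter (λ x → R? x y) xs)) ys)
sum-filter-swap R? []       ys = sym (sum-zeros ys)
  where
  sum-zeros : ∀ {B : Set} (ys : List B) → sum (map (λ _ → 0) ys) ≡ 0
  sum-zeros []       = refl
  sum-zeros (y ∷ ys) = sum-zeros ys
sum-filter-swap {A} {B} R? (x ∷ xs) ys =
  trans (cong (length (filter (R? x) ys) +_) (sum-filter-swap R? xs ys)) (add-row ys)
  where
  column : List A → B → ℕ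
  column xs y = length (filter (λ x → R? x y) xs)
  shift : ∀ a b c → a + (b + c) ≡ b + (a + c)
  shift = solve-∀
  add-row : ∀ ys → length (filter (R? x) ys) + sum (map (column xs) ys) ≡ sum (map (column (x ∷ xs)) ys)
  add-row []       = refl
  add-row (y ∷ ys) with does (R? x y)
  ... | true  = cong suc (trans (shift (length (filter (R? x) ys)) (column xs y) _)
                  (cong (column xs y +_) (add-row ys)))
  ... | false = trans (shift (length (filter (R? x) ys)) (column xs y) _) (cong (column xs y +_) (add-row ys))

-- Counting the subsets of a given size inside a given set

subsetsWithin : ∀ {m} → Subset m → ℕ → List (Subset m) → ℕ
subsetsWithin F k ps = length (filter (_⊆? F) (filter (λ p → ∣ p ∣ ≟ k) ps))

subsetsWithin-++ : ∀ {m} (F : Subset m) k ps qs →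
  subsetsWithin F k (ps ++ qs) ≡ subsetsWithin F k ps + subsetsWithin F k qs
subsetsWithin-++ F k ps qs = begin
  length (filter (_⊆? F) (filter size? (ps ++ qs)))
    ≡⟨ cong (length ∘ filter (_⊆? F)) (filter-++ size? ps qs) ⟩
  length (filter (_⊆? F) (filter size? ps ++ filter size? qs))
    ≡⟨ cong length (filter-++ (_⊆? F) (filter size? ps) _) ⟩
  length (filter (_⊆? F) (filter size? ps) ++ filter (_⊆? F) (filter size? qs))
    ≡⟨ length-++ (filter (_⊆? F) (filter size? ps)) ⟩
  _ ∎
  where
  open ≡-Reasoning
  size? : Decidable (λ p → ∣ p ∣ ≡ k)
  size? p = ∣ p ∣ ≟ k

within-outside : ∀ {m} s (F : Subset m) k ps →
  subsetsWithin (s Vec.∷ F) k (map (outside Vec.∷_) ps) ≡ subsetsWithin F k ps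
within-outside s F k []       = refl
within-outside s F k (p ∷ ps) with ∣ p ∣ ≡ᵇ k
... | false = within-outside s F k ps
... | true with does (p ⊆? F)
...   | false = within-outside s F k ps
...   | true  = cong suc (within-outside s F k ps)

within-inside-suc : ∀ {m} (F : Subset m) k ps →
  subsetsWithin (inside Vec.∷ F) (suc k) (map (inside Vec.∷_) ps) ≡ subsetsWithin F k ps
within-inside-suc F k []       = refl
within-inside-suc F k (p ∷ ps) with ∣ p ∣ ≡ᵇ k
... | false = within-inside-suc F k ps
... | true with does (p ⊆? F)
...   | false = within-inside-suc F k ps
...   | true  = cong suc (within-inside-suc F k ps)

within-inside-zero : ∀ {m} (F : Subset (suc m)) ps → subsetsWithin F 0 (map (inside Vec.∷_) ps) ≡ 0
within-inside-zero F []       = refl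
within-inside-zero F (p ∷ ps) = within-inside-zero F ps

within-inside-outside : ∀ {m} (F : Subset m) k ps →
  subsetsWithin (outside Vec.∷ F) k (map (inside Vec.∷_) ps) ≡ 0
within-inside-outside F zero    ps = within-inside-zero (outside Vec.∷ F) ps
within-inside-outside F (suc k) []       = refl
within-inside-outside F (suc k) (p ∷ ps) with ∣ p ∣ ≡ᵇ k
... | false = within-inside-outside F (suc k) ps
... | true  = within-inside-outside F (suc k) ps

nC0≡1 : ∀ n → n C 0 ≡ 1
nC0≡1 zero    = refl
nC0≡1 (suc n) = refl

-- Pascal's rule on the first element: if it lies in the set, the subsets without it and those with
-- it are the two summands; if not, only the subsets without it remain.
subsetsWithin≡C : ∀ {m} (F : Subset m) k → subsetsWithin F k (allSubsets m) ≡ ∣ F ∣ C k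
subsetsWithin≡C Vec.[] zero    = refl
subsetsWithin≡C Vec.[] (suc k) = refl
subsetsWithin≡C {suc m} (s Vec.∷ F) k =
  trans (subsetsWithin-++ (s Vec.∷ F) k (map (outside Vec.∷_) (allSubsets m)) _)
    (trans (cong₂ _+_ (trans (within-outside s F k (allSubsets m)) (subsetsWithin≡C F k)) refl) (split s k))
  where
  split : ∀ s k → ∣ F ∣ C k + subsetsWithin (s Vec.∷ F) k (map (inside Vec.∷_) (allSubsets m))
    ≡ ∣ s Vec.∷ F ∣ C k
  split outside k       = trans (cong (∣ F ∣ C k +_) (within-inside-outside F k (allSubsets m))) (+-identityʳ _)
  split inside  zero    = trans (cong (∣ F ∣ C 0 +_) (within-inside-zero (inside Vec.∷ F) (allSubsets m)))
                            (trans (+-identityʳ _) (trans (nC0≡1 ∣ F ∣) (sym (nC0≡1 (suc ∣ F ∣)))))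
  split inside  (suc k) = trans (cong (∣ F ∣ C suc k +_)
                              (trans (within-inside-suc F k (allSubsets m)) (subsetsWithin≡C F k)))
                            (trans (+-comm (∣ F ∣ C suc k) _) (nCk+nC[k+1]≡[n+1]C[k+1] ∣ F ∣ k))

-- Sizes of tabulated subsets and the set of attacked spaces

∣∷∣ : ∀ {m} b (p : Subset m) → ∣ b Vec.∷ p ∣ ≡ ⟦ b ⟧ + ∣ p ∣
∣∷∣ true  p = refl
∣∷∣ false p = refl

∣++∣ : ∀ {m n} (p : Subset m) (q : Subset n) → ∣ p Vec.++ q ∣ ≡ ∣ p ∣ + ∣ q ∣
∣++∣ Vec.[]      q = refl
∣++∣ (b Vec.∷ p) q = begin
  ∣ b Vec.∷ (p Vec.++ q) ∣  ≡⟨ ∣∷∣ b (p Vec.++ q) ⟩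
  ⟦ b ⟧ + ∣ p Vec.++ q ∣    ≡⟨ cong (⟦ b ⟧ +_) (∣++∣ p q) ⟩
  ⟦ b ⟧ + (∣ p ∣ + ∣ q ∣)   ≡⟨ +-assoc ⟦ b ⟧ ∣ p ∣ ∣ q ∣ ⟨
  ⟦ b ⟧ + ∣ p ∣ + ∣ q ∣     ≡⟨ cong (_+ ∣ q ∣) (∣∷∣ b p) ⟨
  ∣ b Vec.∷ p ∣ + ∣ q ∣     ∎
  where open ≡-Reasoning

∣tabulate∣ : ∀ m (b : ℕ → Bool) → ∣ Vec.tabulate {n = m} (b ∘ toℕ) ∣ ≡ ∑ m (⟦_⟧ ∘ b)
∣tabulate∣ zero    b = refl
∣tabulate∣ (suc m) b =
  trans (∣∷∣ (b 0) (Vec.tabulate {n = m} (b ∘ suc ∘ toℕ))) (cong (⟦ b 0 ⟧ +_) (∣tabulate∣ m (b ∘ suc)))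

∣concat-tabulate∣ : ∀ {n} m (p : ℕ → Subset n) →
  ∣ Vec.concat (Vec.tabulate {n = m} (p ∘ toℕ)) ∣ ≡ ∑ m (λ i → ∣ p i ∣)
∣concat-tabulate∣ zero    p = refl
∣concat-tabulate∣ (suc m) p =
  trans (∣++∣ (p 0) (Vec.concat (Vec.tabulate {n =
    m} (p ∘ suc ∘ toℕ)))) (cong (∣ p 0 ∣ +_) (∣concat-tabulate∣ m (p ∘ suc)))

module _ (n : ℕ) where

  -- Rows are concatenated in the order in which `combine` numbers the spaces, so that membership is
  -- a table lookup and the size is a sum over rows. The space itself is included.
  attacked : Space n → Subset (n * n)
  attacked (x , y) = Vec.concat (Vec.tabulate {n = n} λ i → Vec.tabulate {n = n} λ j →
    does (∣ toℕ x - toℕ i ∣ ≟ ∣ toℕ y - toℕ j ∣))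

  private
    lookup-attacked : ∀ s i j → Vec.lookup (attacked s) (combine i j) ≡ does (bishopAttacks? n (i , j) s)
    lookup-attacked s@(x , y) i j = begin
      Vec.lookup (attacked s) (combine i j)             ≡⟨ Vec.lookup-concat (Vec.tabulate row) i j ⟩
      Vec.lookup (Vec.lookup (Vec.tabulate row) i) j
        ≡⟨ cong (λ v → Vec.lookup v j) (Vec.lookup∘tabulate row i) ⟩
      Vec.lookup (row i) j                              ≡⟨ Vec.lookup∘tabulate _ j ⟩
      does (bishopAttacks? n (i , j) s)                 ∎
      where
      open ≡-Reasoning
      row : Fin n → Subset n
      row i = Vec.tabulate λ j → does (∣ toℕ x - toℕ i ∣ ≟ ∣ toℕ y - toℕ j ∣)

  ∈-attacked⁺ : ∀ s {i j} → BishopAttacks n (i , j) s → combine i j ∈ˢ attacked s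
  ∈-attacked⁺ s {i} {j} att =
    Vec.lookup⇒[]= (combine i j) (attacked s) (trans (lookup-attacked s i j) (dec-true (bishopAttacks? n (i , j) s) att))

  ∈-attacked⁻ : ∀ s {i j} → combine i j ∈ˢ attacked s → BishopAttacks n (i , j) s
  ∈-attacked⁻ s {i} {j} c∈ = helper (bishopAttacks? n (i , j) s)
    (trans (sym (lookup-attacked s i j)) (Vec.[]=⇒lookup c∈))
    where
    helper : ∀ {P : Set} (P? : Dec P) → does P? ≡ true → P
    helper (yes p) _ = p

  -- A bishop attacks its own space, so the condition that the space be
  -- unoccupied is implied by the others.
  safe⇔ : ∀ B s → Safe n B s ⇔ B ⊆ ∁ (attacked s)
  safe⇔ B s@(x , y) = mk⇔ to from
    where
    to : Safe n B s → B ⊆ ∁ (attacked s)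
    to (_ , unattacked) {c} c∈B = x∉p⇒x∈∁p λ c∈A →
      unattacked _ _ (subst (_∈ˢ B) (sym c≡) c∈B) (∈-attacked⁻ s (subst (_∈ˢ attacked s) (sym c≡) c∈A))
      where c≡ = combine-remQuot {n} n c
    avoid : B ⊆ ∁ (attacked s) → ∀ i j → Occupied n B (i , j) → ¬ BishopAttacks n (i , j) s
    avoid B⊆ i j occ att = x∈p⇒x∉∁p (∈-attacked⁺ s att) (B⊆ occ)
    from : B ⊆ ∁ (attacked s) → Safe n B s
    from B⊆ = (λ occ → avoid B⊆ x y occ (trans (∣n-n∣≡0 (toℕ x)) (sym (∣n-n∣≡0 (toℕ y))))) , avoid B⊆

  spaces : List (Space n)
  spaces = cartesianProduct (allFin n) (allFin n)

  sum-safeCount : sum (map (safeCount n) (configurations n)) ≡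
    sum (map (λ s → (n * n ∸ ∣ attacked s ∣) C n) spaces)
  sum-safeCount = begin
    sum (map (safeCount n) (configurations n))
      ≡⟨ sum-filter-swap (safe? n) (configurations n) spaces ⟩
    sum (map (λ s → length (filter (λ B → safe? n B s) (configurations n))) spaces)
      ≡⟨ cong sum (map-cong count spaces) ⟩
    sum (map (λ s → (n * n ∸ ∣ attacked s ∣) C n) spaces)
      ∎
    where
    open ≡-Reasoning
    count : ∀ s → length (filter (λ B → safe? n B s) (configurations n)) ≡ (n * n ∸ ∣ attacked s ∣) C n
    count s = begin
      length (filter (λ B → safe? n B s) (configurations n))
        ≡⟨ cong length (filter-≐ (λ B → safe? n B s) (_⊆? ∁ (attacked s))
             ((λ {B} → Equivalence.to (safe⇔ B s)) , (λ {B} → Equivalence.from (safe⇔ B s))) (configurations n)) ⟩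
      subsetsWithin (∁ (attacked s)) n (allSubsets (n * n))
        ≡⟨ subsetsWithin≡C (∁ (attacked s)) n ⟩
      ∣ ∁ (attacked s) ∣ C n
        ≡⟨ cong (_C n) (∣∁p∣≡n∸∣p∣ (attacked s)) ⟩
      (n * n ∸ ∣ attacked s ∣) C n ∎

-- The board sum

-- On a line with x spaces before and x′ after the given one, distance 0 occurs once, and each side
-- contributes the distances 1, 2, ... up to its length.
recentre : ∀ x x′ (f : ℕ → ℕ) →
  ∑ (suc (x + x′)) (λ i → f ∣ x - i ∣) ≡ f 0 + (∑ x (f ∘ suc) + ∑ x′ (f ∘ suc))
recentre zero    x′ f = refl
recentre (suc x) x′ f = begin
  f (suc x) + ∑ (suc (x + x′)) (λ i → f ∣ x - i ∣)
    ≡⟨ cong (f (suc x) +_) (recentre x x′ f) ⟩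
  f (suc x) + (f 0 + (∑ x (f ∘ suc) + ∑ x′ (f ∘ suc)))
    ≡⟨ rearrange (f (suc x)) (f 0) (∑ x (f ∘ suc)) _ ⟩
  f 0 + (∑ x (f ∘ suc) + f (suc x) + ∑ x′ (f ∘ suc))
    ≡⟨ cong (λ s → f 0 + (s + ∑ x′ (f ∘ suc))) (∑-last x (f ∘ suc)) ⟨
  f 0 + (∑ (suc x) (f ∘ suc) + ∑ x′ (f ∘ suc)) ∎
  where
  open ≡-Reasoning
  rearrange : ∀ a b c d → a + (b + (c + d)) ≡ b + (c + a + d)
  rearrange = solve-∀

∑∑-diagonal : ∀ u v → ∑ u (λ d → ∑ v (λ e → ⟦ d ≡ᵇ e ⟧)) ≡ u ⊓ v
∑∑-diagonal zero    v       = refl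
∑∑-diagonal (suc u) zero    = ∑-zero u λ _ → refl
∑∑-diagonal (suc u) (suc v) = cong suc (cong₂ _+_ (∑-zero v λ _ → refl) (∑∑-diagonal u v))

-- The lengths of the four diagonal arms from (x , y), one for each quadrant, without the space
-- itself. On ring r they add up to n - 1 + 2r.
arms : ℕ → ℕ → ℕ → ℕ
arms n x y = (x ⊓ y + x ⊓ (n ∸ suc y)) + ((n ∸ suc x) ⊓ y + (n ∸ suc x) ⊓ (n ∸ suc y))

∑∑-diagonals : ∀ n {x y} → x < n → y < n →
  ∑ n (λ i → ∑ n (λ j → ⟦ ∣ x - i ∣ ≡ᵇ ∣ y - j ∣ ⟧)) ≡ suc (arms n x y)
∑∑-diagonals n {x} {y} x<n y<n = begin
  ∑ n (λ i → ∑ n (λ j → ⟦ ∣ x - i ∣ ≡ᵇ ∣ y - j ∣ ⟧))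
    ≡⟨ ∑-cong n (λ {i} _ → onRow ∣ x - i ∣) ⟩
  ∑ n (λ i → row ∣ x - i ∣)
    ≡⟨ cong (λ k → ∑ k (λ i → row ∣ x - i ∣)) (m+[n∸m]≡n x<n) ⟨
  ∑ (suc (x + x′)) (λ i → row ∣ x - i ∣)
    ≡⟨ recentre x x′ row ⟩
  row 0 + (∑ x (row ∘ suc) + ∑ x′ (row ∘ suc))
    ≡⟨ cong₂ _+_ (cong suc (cong₂ _+_ (∑-zero y λ _ → refl) (∑-zero y′ λ _ → refl)))
         (cong₂ _+_ (rows x) (rows x′)) ⟩
  suc (arms n x y) ∎
  where
  open ≡-Reasoning
  x′ = n ∸ suc x
  y′ = n ∸ suc y
  row : ℕ → ℕ
  row d = ⟦ d ≡ᵇ 0 ⟧ + (∑ y (λ e → ⟦ d ≡ᵇ suc e ⟧) + ∑ y′ (λ e → ⟦ d ≡ᵇ suc e ⟧))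
  onRow : ∀ d → ∑ n (λ j → ⟦ d ≡ᵇ ∣ y - j ∣ ⟧) ≡ row d
  onRow d = trans (cong (λ k → ∑ k (λ j → ⟦ d ≡ᵇ ∣ y - j ∣ ⟧)) (sym (m+[n∸m]≡n y<n)))
    (recentre y y′ (λ e → ⟦ d ≡ᵇ e ⟧))
  rows : ∀ u → ∑ u (row ∘ suc) ≡ u ⊓ y + u ⊓ y′
  rows u = trans (∑-distrib-+ u _ _) (cong₂ _+_ (∑∑-diagonal u y) (∑∑-diagonal u y′))

∣attacked∣ : ∀ n (s : Space n) → ∣ attacked n s ∣ ≡ suc (arms n (toℕ (proj₁ s)) (toℕ (proj₂ s)))
∣attacked∣ n (x , y) = trans (∣concat-tabulate∣ n row)
  (trans (∑-cong n λ {i} _ → ∣tabulate∣ n (λ j → ∣ toℕ x - i ∣ ≡ᵇ ∣ toℕ y - j ∣))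
    (∑∑-diagonals n (toℕ<n x) (toℕ<n y)))
  where
  row : ℕ → Vec Bool n
  row i = Vec.tabulate λ j → ∣ toℕ x - i ∣ ≡ᵇ ∣ toℕ y - toℕ j ∣

boardSum : ℕ → (ℕ → ℕ) → ℕ
boardSum n φ = ∑ n λ x → ∑ n λ y → φ (arms n x y)

sum-safeCount≡boardSum : ∀ n → sum (map (safeCount n) (configurations n)) ≡
  boardSum n (λ a → (n * n ∸ suc a) C n)
sum-safeCount≡boardSum n = begin
  sum (map (safeCount n) (configurations n))
    ≡⟨ sum-safeCount n ⟩
  sum (map (λ s → (n * n ∸ ∣ attacked n s ∣) C n) (spaces n))
    ≡⟨ cong sum (map-cong (λ s → cong (λ a → (n * n ∸ a) C n) (∣attacked∣ n s)) (spaces n)) ⟩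
  sum (map (λ s → φ (arms n (toℕ (proj₁ s)) (toℕ (proj₂ s)))) (spaces n))
    ≡⟨ sum-cartesianProduct _ (allFin n) (allFin n) ⟩
  sum (map (λ x → sum (map (λ y → φ (arms n (toℕ x) (toℕ y))) (allFin n))) (allFin n))
    ≡⟨ cong sum (map-cong (λ x → sum-allFin n (λ y → φ (arms n (toℕ x) y))) (allFin n)) ⟩
  sum (map (λ x → ∑ n (λ y → φ (arms n (toℕ x) y))) (allFin n))
    ≡⟨ sum-allFin n (λ x → ∑ n (λ y → φ (arms n x y))) ⟩
  boardSum n φ ∎
  where
  open ≡-Reasoning
  φ : ℕ → ℕ
  φ a = (n * n ∸ suc a) C n

arms-comm : ∀ n x y → arms n x y ≡ arms n y x
arms-comm n x y = trans
  (cong₂ _+_ (cong₂ _+_ (⊓-comm x y) (⊓-comm x y′)) (cong₂ _+_ (⊓-comm x′ y) (⊓-comm x′ y′)))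
  (swap (y ⊓ x) (y′ ⊓ x) (y ⊓ x′) (y′ ⊓ x′))
  where
  x′ = n ∸ suc x
  y′ = n ∸ suc y
  swap : ∀ a b c d → a + b + (c + d) ≡ a + c + (b + d)
  swap = solve-∀

module _ (n : ℕ) where

  private
    edge : ∀ {y} → y < 2 + n → suc n ⊓ y + suc n ⊓ (suc n ∸ y) ≡ suc n
    edge {y} (s≤s y≤) = trans
      (cong₂ _+_ (m≥n⇒m⊓n≡n y≤) (m≥n⇒m⊓n≡n (m∸n≤m (suc n) y)))
      (m+[n∸m]≡n y≤)

  arms-first : ∀ {y} → y < 2 + n → arms (2 + n) 0 y ≡ suc n
  arms-first = edge

  arms-last : ∀ {y} → y < 2 + n → arms (2 + n) (suc n) y ≡ suc n
  arms-last {y} y< = trans (cong (λ z → edgeSum + (z ⊓ y + z ⊓ (suc n ∸ y))) (n∸n≡0 n))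
    (trans (+-identityʳ edgeSum) (edge y<))
    where edgeSum = suc n ⊓ y + suc n ⊓ (suc n ∸ y)

  -- A border around a board of side n prolongs each of the four arms by one space.
  arms-interior : ∀ {x y} → x < n → y < n → arms (2 + n) (suc x) (suc y) ≡ 4 + arms n x y
  arms-interior {x} {y} x<n y<n rewrite +-∸-assoc 1 x<n | +-∸-assoc 1 y<n =
    collect (x ⊓ y) (x ⊓ (n ∸ suc y)) ((n ∸ suc x) ⊓ y) ((n ∸ suc x) ⊓ (n ∸ suc y))
    where
    collect : ∀ a b c d → (suc a + suc b) + (suc c + suc d) ≡ 4 + ((a + b) + (c + d))
    collect = solve-∀

  -- The border consists of 2 (n + 2) + 2 n = 4 (n + 1) spaces, all with the same arm total n + 1.
  -- What is left is a board of side n whose arm totals are raised by 4.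
  boardSum-peel : ∀ φ → boardSum (2 + n) φ ≡ 4 * (suc n * φ (suc n)) + boardSum n (φ ∘ (4 +_))
  boardSum-peel φ = begin
    boardSum (2 + n) φ
      ≡⟨ cong₂ _+_ (constant {0} arms-first) (∑-last n (row ∘ suc)) ⟩
    (2 + n) * c + (∑ n (row ∘ suc) + row (suc n))
      ≡⟨ cong₂ (λ r s → (2 + n) * c + (r + s)) (∑-cong n interior) (constant {suc n} arms-last) ⟩
    (2 + n) * c + (∑ n (λ x → c + c + inner x) + (2 + n) * c)
      ≡⟨ cong (λ r → (2 + n) * c + (r + (2 + n) * c))
           (trans (∑-distrib-+ n (λ _ → c + c) inner) (cong (_+ ∑ n inner) (∑-const n (c + c)))) ⟩
    (2 + n) * c + (n * (c + c) + ∑ n inner + (2 + n) * c)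
      ≡⟨ collect n c (∑ n inner) ⟩
    4 * (suc n * c) + boardSum n (φ ∘ (4 +_)) ∎
    where
    open ≡-Reasoning
    c = φ (suc n)
    row inner : ℕ → ℕ
    row x = ∑ (2 + n) (λ y → φ (arms (2 + n) x y))
    inner x = ∑ n (λ y → φ (4 + arms n x y))
    constant : ∀ {x} → (∀ {y} → y < 2 + n → arms (2 + n) x y ≡ suc n) → row x ≡ (2 + n) * c
    constant arms≡ = trans (∑-cong (2 + n) (λ y< → cong φ (arms≡ y<))) (∑-const (2 + n) c)
    collect : ∀ n c r → (2 + n) * c + (n * (c + c) + r + (2 + n) * c) ≡ 4 * (suc n * c) + r
    collect = solve-∀
    interior : ∀ {x} → x < n → row (suc x) ≡ c + c + inner x
    interior {x} x<n = begin
      φ (arms (2 + n) (suc x) 0) + ∑ (suc n) (λ y → φ (arms (2 + n) (suc x) (suc y)))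
        ≡⟨ cong₂ _+_ (side {0} arms-first) (∑-last n (λ y → φ (arms (2 + n) (suc x) (suc y)))) ⟩
      c + (∑ n (λ y → φ (arms (2 + n) (suc x) (suc y))) + φ (arms (2 + n) (suc x) (suc n)))
        ≡⟨ cong₂ (λ r s → c + (r + s)) (∑-cong n (λ y<n → cong φ (arms-interior x<n y<n))) (side {suc n} arms-last) ⟩
      c + (inner x + c)
        ≡⟨ rotate c (inner x) ⟩
      c + c + inner x ∎
      where
      side : ∀ {z} → (∀ {y} → y < 2 + n → arms (2 + n) z y ≡ suc n) → φ (arms (2 + n) (suc x) z) ≡ c
      side {z} arms≡ = cong φ (trans (arms-comm (2 + n) (suc x) z) (arms≡ (s≤s (m≤n⇒m≤1+n x<n))))
      rotate : ∀ c r → c + (r + c) ≡ c + c + r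
      rotate = solve-∀

-- The sum of (n - 1 - i) h(i) over i < n, or equally of h(i) over all pairs with i + j < n - 1. As
-- an iterated sum it can be evaluated by two hockey-stick summations.
triangleSum : ℕ → (ℕ → ℕ) → ℕ
triangleSum zero    h = 0
triangleSum (suc n) h = n * h 0 + triangleSum n (h ∘ suc)

triangleSum-cong : ∀ n {f g : ℕ → ℕ} → (∀ i → f i ≡ g i) → triangleSum n f ≡ triangleSum n g
triangleSum-cong zero    f≗g = refl
triangleSum-cong (suc n) f≗g = cong₂ (λ a b → n * a + b) (f≗g 0) (triangleSum-cong n (λ i → f≗g (suc i)))

Antitone : (ℕ → ℕ) → Set
Antitone φ = ∀ {a b} → a ≤ b → φ b ≤ φ a

-- A ring attacked from a = n + 2r spaces has 4 (n - 1 - 2r) elements (one at the centre of an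
-- odd board); half of them are counted with a + 1 in the lower bound, with a - 1 in the upper.
boardSum-lower : ∀ n φ → Antitone φ →
  2 * triangleSum n (λ m → φ (n + m)) ≤ boardSum n (φ ∘ suc)
boardSum-lower zero          φ anti = z≤n
boardSum-lower (suc zero)    φ anti = z≤n
boardSum-lower (suc (suc n)) φ anti = begin
  2 * (suc n * h 0 + (n * h 1 + t))
    ≤⟨ *-monoʳ-≤ 2 (+-monoʳ-≤ (suc n * h 0) (+-monoˡ-≤ t (*-mono-≤ (n≤1+n n) (anti (+-monoʳ-≤ (2 + n) z≤n))))) ⟩
  2 * (suc n * h 0 + (suc n * h 0 + t))
    ≡⟨ collect (suc n * h 0) t ⟩
  4 * (suc n * h 0) + 2 * t
    ≤⟨ +-mono-≤ (≤-reflexive (cong (λ k → 4 * (suc n * φ k)) (+-identityʳ (2 + n))))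
         (≤-trans (≤-reflexive (cong (2 *_) (triangleSum-cong n λ m → cong φ (reindex n m))))
           (boardSum-lower n (φ ∘ (4 +_)) (λ a≤b → anti (+-monoʳ-≤ 4 a≤b)))) ⟩
  4 * (suc n * φ (2 + n)) + boardSum n (φ ∘ (4 +_) ∘ suc)
    ≡⟨ boardSum-peel n (φ ∘ suc) ⟨
  boardSum (2 + n) (φ ∘ suc) ∎
  where
  open ≤-Reasoning
  h : ℕ → ℕ
  h m = φ (2 + n + m)
  t = triangleSum n (h ∘ (2 +_))
  collect : ∀ a t → 2 * (a + (a + t)) ≡ 4 * a + 2 * t
  collect = solve-∀
  reindex : ∀ n m → 2 + n + (2 + m) ≡ 4 + (n + m)
  reindex = solve-∀

boardSum-upper : ∀ n φ → Antitone φ →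
  boardSum n (φ ∘ suc) ≤ 2 * (n * φ n) + 2 * triangleSum n (λ m → φ (n + m))
boardSum-upper zero          φ anti = z≤n
boardSum-upper (suc zero)    φ anti = ≤-trans (m≤m+n _ (φ 1)) (≤-reflexive (double (φ 1)))
  where
  double : ∀ a → a + 0 + 0 + a ≡ 2 * (1 * a) + 0
  double = solve-∀
boardSum-upper (suc (suc n)) φ anti = begin
  boardSum (2 + n) (φ ∘ suc)
    ≡⟨ boardSum-peel n (φ ∘ suc) ⟩
  4 * (suc n * φ (2 + n)) + boardSum n (φ ∘ (4 +_) ∘ suc)
    ≤⟨ +-monoʳ-≤ (4 * (suc n * φ (2 + n))) (boardSum-upper n (φ ∘ (4 +_)) (λ a≤b → anti (+-monoʳ-≤ 4 a≤b))) ⟩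
  4 * (suc n * φ (2 + n)) + (2 * (n * φ (4 + n)) + 2 * triangleSum n (λ m → φ (4 + (n + m))))
    -- The excess `2 * (n * φ (4 + n))` of the inner board, lowered by one in its argument, becomes
    -- the index-1 term of the outer triangle sum. The border has to supply the index-0 term and the
    -- new excess.
    ≤⟨ +-mono-≤ (≤-refl {4 * (suc n * φ (2 + n))}) (+-mono-≤
         (*-monoʳ-≤ 2 (*-monoʳ-≤ n (anti (≤-trans (≤-reflexive (+-comm (2 + n) 1)) (n≤1+n (3 + n))))))
         (≤-reflexive (cong (2 *_) (triangleSum-cong n λ m → cong φ (sym (reindex n m)))))) ⟩
  4 * (suc n * φ (2 + n)) + (2 * (n * h 1) + 2 * t)
    -- The border has 4 (n + 1) spaces, two fewer than the 2 (n + 2) + 2 (n + 1) that are needed.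
    ≤⟨ m≤m+n _ (2 * φ (2 + n)) ⟩
  4 * (suc n * φ (2 + n)) + (2 * (n * h 1) + 2 * t) + 2 * φ (2 + n)
    ≡⟨ collect n (φ (2 + n)) (h 1) t ⟩
  2 * ((2 + n) * φ (2 + n)) + 2 * (suc n * φ (2 + n) + (n * h 1 + t))
    ≡⟨ cong (λ k → 2 * ((2 + n) * φ (2 + n)) + 2 * (suc n * φ k + (n * h 1 + t))) (+-identityʳ (2 + n)) ⟨
  2 * ((2 + n) * φ (2 + n)) + 2 * triangleSum (2 + n) h ∎
  where
  open ≤-Reasoning
  h : ℕ → ℕ
  h m = φ (2 + n + m)
  t = triangleSum n (h ∘ (2 +_))
  collect : ∀ n a b t → 4 * (suc n * a) + (2 * (n * b) + 2 * t) + 2 * a ≡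
    2 * ((2 + n) * a) + 2 * (suc n * a + (n * b + t))
  collect = solve-∀
  reindex : ∀ n m → 2 + n + (2 + m) ≡ 4 + (n + m)
  reindex = solve-∀

-- Binomial coefficients

pascal : ∀ n k → suc n C suc k ≡ n C k + n C suc k
pascal n k = sym (nCk+nC[k+1]≡[n+1]C[k+1] n k)

C-monoˡ-≤ : ∀ k {m n} → m ≤ n → m C k ≤ n C k
C-monoˡ-≤ k {m} {n} m≤n = subst (λ o → m C k ≤ o C k) (m∸n+n≡m m≤n) (grow (n ∸ m))
  where
  step : ∀ n k → n C k ≤ suc n C k
  step n zero    = ≤-reflexive (trans (nC0≡1 n) (sym (nC0≡1 (suc n))))
  step n (suc k) = ≤-trans (m≤n+m (n C suc k) (n C k)) (≤-reflexive (sym (pascal n k)))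
  grow : ∀ d → m C k ≤ (d + m) C k
  grow zero    = ≤-refl
  grow (suc d) = ≤-trans (grow d) (step (d + m) k)

C-absorb : ∀ n k → suc k * (suc n C suc k) ≡ suc n * (n C k)
C-absorb zero    zero    = refl
C-absorb zero    (suc k) = *-zeroʳ (suc (suc k))
C-absorb (suc n) zero    = begin
  1 * (suc (suc n) C 1)        ≡⟨ cong (1 *_) (pascal (suc n) 0) ⟩
  1 * (1 + suc n C 1)          ≡⟨ cong suc (trans (+-identityʳ _) (sym (*-identityˡ (suc n C 1)))) ⟨
  1 + 1 * (suc n C 1)          ≡⟨ cong suc (trans (C-absorb n 0) (cong (suc n *_) (nC0≡1 n))) ⟩
  suc (suc n) * 1              ∎
  where open ≡-Reasoning
C-absorb (suc n) (suc k) = begin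
  suc (suc k) * (suc (suc n) C suc (suc k))
    ≡⟨ cong (suc (suc k) *_) (pascal (suc n) (suc k)) ⟩
  suc (suc k) * (c + suc n C suc (suc k))
    ≡⟨ expand (suc k) c (suc n C suc (suc k)) ⟩
  c + (suc k * c + suc (suc k) * (suc n C suc (suc k)))
    ≡⟨ cong (c +_) (cong₂ _+_ (C-absorb n k) (C-absorb n (suc k))) ⟩
  c + (suc n * (n C k) + suc n * (n C suc k))
    ≡⟨ cong (c +_) (trans (sym (*-distribˡ-+ (suc n) (n C k) (n C suc k))) (cong (suc n *_) (sym (pascal n k)))) ⟩
  suc (suc n) * c ∎
  where
  open ≡-Reasoning
  c = suc n C suc k
  expand : ∀ k c d → suc k * (c + d) ≡ c + (k * c + suc k * d)
  expand = solve-∀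

-- The hockey-stick identity, applied twice.
triangleSum-C : ∀ n l k → triangleSum n (λ m → (n + l ∸ m) C k) + (2 + (n + l)) C (2 + k) ≡
  n * (suc (n + l) C suc k) + (2 + l) C (2 + k)
triangleSum-C zero    l k = refl
triangleSum-C (suc n) l k = begin
  n * (suc N C k) + t + suc (2 + N) C (2 + k)
    ≡⟨ cong (n * (suc N C k) + t +_) (pascal (2 + N) (suc k)) ⟩
  n * (suc N C k) + t + ((2 + N) C suc k + (2 + N) C (2 + k))
    ≡⟨ regroup (n * (suc N C k)) t ((2 + N) C suc k) ((2 + N) C (2 + k)) ⟩
  n * (suc N C k) + (2 + N) C suc k + (t + (2 + N) C (2 + k))
    ≡⟨ cong (n * (suc N C k) + (2 + N) C suc k +_) (triangleSum-C n l k) ⟩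
  n * (suc N C k) + (2 + N) C suc k + (n * (suc N C suc k) + (2 + l) C (2 + k))
    ≡⟨ factor n (suc N C k) (suc N C suc k) ((2 + N) C suc k) _ ⟩
  n * (suc N C k + suc N C suc k) + (2 + N) C suc k + (2 + l) C (2 + k)
    ≡⟨ cong (λ c → n * c + (2 + N) C suc k + (2 + l) C (2 + k)) (sym (pascal (suc N) k)) ⟩
  n * ((2 + N) C suc k) + (2 + N) C suc k + (2 + l) C (2 + k)
    ≡⟨ cong (_+ (2 + l) C (2 + k)) (+-comm (n * ((2 + N) C suc k)) _) ⟩
  suc n * ((2 + N) C suc k) + (2 + l) C (2 + k) ∎
  where
  open ≡-Reasoning
  N = n + l
  t = triangleSum n (λ m → (N ∸ m) C k)
  regroup : ∀ a t b c → a + t + (b + c) ≡ a + b + (t + c)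
  regroup = solve-∀
  factor : ∀ n a b c d → n * a + c + (n * b + d) ≡ n * (a + b) + c + d
  factor = solve-∀

-- C(n,k) / C(m,k) is the product of the factors (n - j) / (m - j) over j < k, each at most a/b by
-- hypothesis; `C-absorb` splits off one factor at a time. If m runs out while n does not, the
-- hypothesis forces b = 0.
C-ratio : ∀ k {m n a b} → (∀ {j} → j < k → (n ∸ j) * b ≤ (m ∸ j) * a) → (n C k) * b ^ k ≤ (m C k) * a ^ k
C-ratio zero    {m} {n} h = ≤-reflexive (cong (_* 1) (trans (nC0≡1 n) (sym (nC0≡1 m))))
C-ratio (suc k) {m}     {zero}                h = z≤n
C-ratio (suc k) {zero}  {suc n} {a} {zero}    h = ≤-reflexive (*-zeroʳ (suc n C suc k))
C-ratio (suc k) {zero}  {suc n} {a} {suc b}   h = contradiction (h {0} (s≤s z≤n)) λ ()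
C-ratio (suc k) {suc m} {suc n} {a} {b}       h = *-cancelˡ-≤ (suc k) (begin
  suc k * ((suc n C suc k) * (b * b ^ k))    ≡⟨ *-assoc (suc k) (suc n C suc k) _ ⟨
  suc k * (suc n C suc k) * (b * b ^ k)      ≡⟨ cong (_* (b * b ^ k)) (C-absorb n k) ⟩
  suc n * (n C k) * (b * b ^ k)              ≡⟨ interchange (suc n) (n C k) b (b ^ k) ⟩
  suc n * b * ((n C k) * b ^ k)
    ≤⟨ *-mono-≤ (h {0} (s≤s z≤n)) (C-ratio k {m} {n} (λ j<k → h (s≤s j<k))) ⟩
  suc m * a * ((m C k) * a ^ k)              ≡⟨ interchange (suc m) (m C k) a (a ^ k) ⟨
  suc m * (m C k) * (a * a ^ k)              ≡⟨ cong (_* (a * a ^ k)) (C-absorb m k) ⟨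
  suc k * (suc m C suc k) * (a * a ^ k)      ≡⟨ *-assoc (suc k) (suc m C suc k) _ ⟩
  suc k * ((suc m C suc k) * (a * a ^ k))    ∎)
  where
  open ≤-Reasoning
  interchange : ∀ n c b p → n * c * (b * p) ≡ n * b * (c * p)
  interchange = solve-∀

-- Bounds for the total number of safe spaces

totalSafe : ℕ → ℕ
totalSafe n = sum (map (safeCount n) (configurations n))

^-distrib-* : ∀ a b e → (a * b) ^ e ≡ a ^ e * b ^ e
^-distrib-* a b zero    = refl
^-distrib-* a b (suc e) = trans (cong (a * b *_) (^-distrib-* a b e)) (interchange a b (a ^ e) (b ^ e))
  where
  interchange : ∀ a b x y → a * b * (x * y) ≡ a * x * (b * y)
  interchange = solve-∀

≤-from-+ : ∀ {a b} d → a + d ≡ b → a ≤ b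
≤-from-+ {a} d eq = ≤-trans (m≤m+n a d) (≤-reflexive eq)

-- Here n = 2 + m and k = n² - 2n; b counts the configurations, and 2q approximates
-- the total number of safe spaces over all of them.
module Estimates (m : ℕ) where

  n k b c₀ q : ℕ
  n = 2 + m
  k = m * n
  b = (n * n) C n
  c₀ = k C n
  q = (2 + k) C (2 + n)

  n²≡ : n * n ≡ n + (n + k)
  n²≡ = eq m
    where
    eq : ∀ m → (2 + m) * (2 + m) ≡ (2 + m) + ((2 + m) + m * (2 + m))
    eq = solve-∀

  private
    t c₁ c₂ : ℕ
    t = triangleSum n (λ i → (n * n ∸ (n + i)) C n)
    c₁ = suc (n + k) C suc n
    c₂ = (2 + (n + k)) C (2 + n)

    antitone : Antitone (λ a → (n * n ∸ a) C n)
    antitone a≤b = C-monoˡ-≤ n (∸-monoʳ-≤ (n * n) a≤b)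

    -- The triangle sum descends from C(n + k, n), since n² - n = n + k. By `c₂≤nc₁` and `nc₁≤` the
    -- terms n c₁ and c₂ differ by at most 3 n b, so t agrees with q up to that error.
    t+c₂ : t + c₂ ≡ n * c₁ + q
    t+c₂ = trans (cong (_+ c₂) (triangleSum-cong n λ i → cong (_C n) (shift i))) (triangleSum-C n k n)
      where
      shift : ∀ i → n * n ∸ (n + i) ≡ n + k ∸ i
      shift i = trans (sym (∸-+-assoc (n * n) n i)) (cong (_∸ i) (trans (cong (_∸ n) n²≡) (m+n∸m≡n n (n + k))))

    absorb : (2 + n) * c₂ ≡ (2 + (n + k)) * c₁
    absorb = C-absorb (suc (n + k)) (suc n)

    c₂≤nc₁ : c₂ ≤ n * c₁
    c₂≤nc₁ = *-cancelˡ-≤ (2 + n) (begin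
      (2 + n) * c₂             ≡⟨ absorb ⟩
      (2 + (n + k)) * c₁       ≤⟨ *-monoˡ-≤ c₁ (≤-from-+ (2 + 3 * m + 2) (eq m)) ⟩
      (2 + n) * n * c₁         ≡⟨ *-assoc (2 + n) n c₁ ⟩
      (2 + n) * (n * c₁)       ∎)
      where
      open ≤-Reasoning
      eq : ∀ m → 2 + ((2 + m) + m * (2 + m)) + (2 + 3 * m + 2) ≡ (2 + (2 + m)) * (2 + m)
      eq = solve-∀

    c₁≤nb : c₁ ≤ n * b
    c₁≤nb = *-cancelˡ-≤ (suc n) (begin
      suc n * c₁                   ≡⟨ C-absorb (n + k) n ⟩
      suc (n + k) * ((n + k) C n)  ≤⟨ *-mono-≤ (≤-from-+ (3 + 2 * m) (eq m))
                                       (C-monoˡ-≤ n (≤-trans (m≤n+m (n + k) n) (≤-reflexive (sym n²≡)))) ⟩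
      suc n * n * b                ≡⟨ *-assoc (suc n) n b ⟩
      suc n * (n * b)              ∎)
      where
      open ≤-Reasoning
      eq : ∀ m → suc ((2 + m) + m * (2 + m)) + (3 + 2 * m) ≡ suc (2 + m) * (2 + m)
      eq = solve-∀

    -- By `absorb`, (n + 2)(n c₁ - c₂) = ((n + 2) n - (n² - n + 2)) c₁ = (3n - 2) c₁, and c₁ ≤ n b.
    nc₁≤ : n * c₁ ≤ c₂ + 3 * (n * b)
    nc₁≤ = *-cancelˡ-≤ (2 + n) (begin
      (2 + n) * (n * c₁)                     ≡⟨ *-assoc (2 + n) n c₁ ⟨
      (2 + n) * n * c₁                       ≤⟨ *-monoˡ-≤ c₁ (≤-from-+ 2 (eq m)) ⟩
      (2 + (n + k) + 3 * n) * c₁             ≡⟨ *-distribʳ-+ c₁ (2 + (n + k)) (3 * n) ⟩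
      (2 + (n + k)) * c₁ + 3 * n * c₁        ≤⟨ +-mono-≤ (≤-reflexive (sym absorb))
                                                 (*-mono-≤ (*-monoʳ-≤ 3 (m≤n+m n 2)) c₁≤nb) ⟩
      (2 + n) * c₂ + 3 * (2 + n) * (n * b)   ≡⟨ factor (2 + n) c₂ (n * b) ⟩
      (2 + n) * (c₂ + 3 * (n * b))           ∎)
      where
      open ≤-Reasoning
      eq : ∀ m → (2 + (2 + m)) * (2 + m) + 2 ≡ 2 + ((2 + m) + m * (2 + m)) + 3 * (2 + m)
      eq = solve-∀
      factor : ∀ n c b → n * c + 3 * n * b ≡ n * (c + 3 * b)
      factor = solve-∀

  totalSafe-lower : 2 * q ≤ totalSafe n
  totalSafe-lower = begin
    2 * q                                        ≤⟨ *-monoʳ-≤ 2 q≤t ⟩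
    2 * t                                        ≤⟨ boardSum-lower n (λ a → (n * n ∸ a) C n) antitone ⟩
    boardSum n (λ a → (n * n ∸ suc a) C n)       ≡⟨ sum-safeCount≡boardSum n ⟨
    totalSafe n                                  ∎
    where
    open ≤-Reasoning
    q≤t : q ≤ t
    q≤t = +-cancelˡ-≤ (n * c₁) q t (≤-trans (≤-reflexive (sym t+c₂))
      (≤-trans (+-monoʳ-≤ t c₂≤nc₁) (≤-reflexive (+-comm t (n * c₁)))))

  -- The 8 is made of 2 from the excess term of `boardSum-upper` and twice the 3 of `nc₁≤`.
  totalSafe-upper : totalSafe n ≤ 2 * q + 8 * (n * b)
  totalSafe-upper = begin
    totalSafe n                                  ≡⟨ sum-safeCount≡boardSum n ⟩
    boardSum n (λ a → (n * n ∸ suc a) C n)       ≤⟨ boardSum-upper n (λ a → (n * n ∸ a) C n) antitone ⟩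
    2 * (n * ((n * n ∸ n) C n)) + 2 * t
      ≤⟨ +-mono-≤ (*-monoʳ-≤ 2 (*-monoʳ-≤ n (C-monoˡ-≤ n (m∸n≤m (n * n) n))))
                                                     (*-monoʳ-≤ 2 t≤) ⟩
    2 * (n * b) + 2 * (q + 3 * (n * b))          ≡⟨ collect (n * b) q ⟩
    2 * q + 8 * (n * b)                          ∎
    where
    open ≤-Reasoning
    collect : ∀ b q → 2 * b + 2 * (q + 3 * b) ≡ 2 * q + 8 * b
    collect = solve-∀
    swap : ∀ a b q → a + b + q ≡ q + b + a
    swap = solve-∀
    t≤ : t ≤ q + 3 * (n * b)
    t≤ = +-cancelʳ-≤ c₂ t (q + 3 * (n * b)) (≤-trans (≤-reflexive t+c₂)
      (≤-trans (+-monoˡ-≤ q nc₁≤) (≤-reflexive (swap c₂ (3 * (n * b)) q))))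

  -- Two absorptions lower the index n + 2 to n, so that c₀ can be compared with b factor by factor.
  -- The prefactor (k + 2)(k + 1) / ((n + 2)(n + 1)) is n² up to a factor 1 - O(1/n).
  q-absorb : (2 + n) * suc n * q ≡ (2 + k) * suc k * c₀
  q-absorb = begin
    (2 + n) * suc n * q                      ≡⟨ swap (2 + n) (suc n) q ⟩
    suc n * ((2 + n) * q)                    ≡⟨ cong (suc n *_) (C-absorb (suc k) (suc n)) ⟩
    suc n * ((2 + k) * (suc k C suc n))      ≡⟨ rotate (suc n) (2 + k) (suc k C suc n) ⟩
    (2 + k) * (suc n * (suc k C suc n))      ≡⟨ cong ((2 + k) *_) (C-absorb k n) ⟩
    (2 + k) * (suc k * c₀)                   ≡⟨ *-assoc (2 + k) (suc k) c₀ ⟨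
    (2 + k) * suc k * c₀                     ∎
    where
    open ≡-Reasoning
    swap : ∀ a b q → a * b * q ≡ b * (a * q)
    swap = solve-∀
    rotate : ∀ a b q → a * (b * q) ≡ b * (a * q)
    rotate = solve-∀

  private
    q≤n²c₀ : q ≤ n * n * c₀
    q≤n²c₀ = *-cancelˡ-≤ ((2 + n) * suc n) (begin
      (2 + n) * suc n * q             ≡⟨ q-absorb ⟩
      (2 + k) * suc k * c₀            ≤⟨ *-monoˡ-≤ c₀ {(2 + k) * suc k} (*-mono-≤ le₁ le₂) ⟩
      n * n * ((2 + n) * suc n) * c₀  ≡⟨ regroup (n * n) ((2 + n) * suc n) c₀ ⟩
      (2 + n) * suc n * (n * n * c₀)  ∎)
      where
      open ≤-Reasoning
      eq₁ : ∀ m → 2 + m * (2 + m) + (2 + 2 * m) ≡ (2 + m) * (2 + m)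
      eq₁ = solve-∀
      eq₂ : ∀ m → suc (m * (2 + m)) + (11 + 5 * m) ≡ (2 + (2 + m)) * suc (2 + m)
      eq₂ = solve-∀
      le₁ : 2 + k ≤ n * n
      le₁ = ≤-from-+ (2 + 2 * m) (eq₁ m)
      le₂ : suc k ≤ (2 + n) * suc n
      le₂ = ≤-from-+ (11 + 5 * m) (eq₂ m)
      regroup : ∀ a b c → a * b * c ≡ b * (a * c)
      regroup = solve-∀

  -- Each factor (k - j) / (n² - j) is at most k/n², and k + 1 = (n - 1)², so it stays below (1 -
  -- 1/n)².
  c₀-upper : c₀ * (n * n) ^ n ≤ b * (suc m * suc m) ^ n
  c₀-upper = C-ratio n {n * n} {k} λ {j} j<n → begin
    (k ∸ j) * (n * n)                             ≡⟨ *-distribʳ-∸ (n * n) k j ⟩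
    k * (n * n) ∸ j * (n * n)
      ≤⟨ ∸-mono (≤-from-+ (n * n) (eq m)) (*-monoʳ-≤ j (*-mono-≤ (n≤1+n (suc m)) (n≤1+n (suc m)))) ⟩
    n * n * (suc m * suc m) ∸ j * (suc m * suc m) ≡⟨ *-distribʳ-∸ (suc m * suc m) (n * n) j ⟨
    (n * n ∸ j) * (suc m * suc m)                 ∎
    where
    open ≤-Reasoning
    eq : ∀ m → m * (2 + m) * ((2 + m) * (2 + m)) + (2 + m) * (2 + m) ≡ (2 + m) * (2 + m) * (suc m * suc m)
    eq = solve-∀

  q-upper : q * (n * n) ^ n ≤ n * (n * b) * (suc m * suc m) ^ n
  q-upper = begin
    q * (n * n) ^ n                            ≤⟨ *-monoˡ-≤ ((n * n) ^ n) q≤n²c₀ ⟩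
    n * n * c₀ * (n * n) ^ n                   ≡⟨ *-assoc (n * n) c₀ _ ⟩
    n * n * (c₀ * (n * n) ^ n)                 ≤⟨ *-monoʳ-≤ (n * n) c₀-upper ⟩
    n * n * (b * (suc m * suc m) ^ n)          ≡⟨ regroup n b ((suc m * suc m) ^ n) ⟩
    n * (n * b) * (suc m * suc m) ^ n          ∎
    where
    open ≤-Reasoning
    regroup : ∀ n b p → n * n * (b * p) ≡ n * (n * b) * p
    regroup = solve-∀

-- Bernoulli's inequality for (1 - 1/(p + 1))^(i + 1), cleared of denominators.
bernoulli : ∀ p i → suc p ^ suc i ≤ p ^ suc i + suc i * suc p ^ i
bernoulli p zero    = ≤-reflexive (+-comm 1 (p * 1))
bernoulli p (suc i) = begin
  suc p ^ suc i + p * suc p ^ suc i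
    ≤⟨ +-monoʳ-≤ (suc p ^ suc i) (*-monoʳ-≤ p (bernoulli p i)) ⟩
  suc p ^ suc i + p * (p ^ suc i + suc i * suc p ^ i)
    ≡⟨ expand (suc p ^ suc i) p (p ^ suc i) (suc i) (suc p ^ i) ⟩
  p ^ (2 + i) + (suc p ^ suc i + suc i * (p * suc p ^ i))
    ≤⟨ +-monoʳ-≤ (p ^ (2 + i)) (+-monoʳ-≤ (suc p ^ suc i) (*-monoʳ-≤ (suc i) (*-monoˡ-≤ (suc p ^ i) (n≤1+n p)))) ⟩
  p ^ (2 + i) + (2 + i) * suc p ^ suc i ∎
  where
  open ≤-Reasoning
  expand : ∀ x p y j z → x + p * (y + j * z) ≡ p * y + (x + j * (p * z))
  expand = solve-∀

-- In fractions: v/u ≥ 1 - 6/x and w/(c n²) ≥ 1 - 7/n give a product of at least 1 - 13/n. The bound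
-- w ≤ c n x turns the loss 6/x into 6/n.
scaled-bound : ∀ {u v r w c n x} → u ≡ x * r → u ≤ v + 6 * r → w ≤ c * n * x →
  c * (n * n) ≤ w + 7 * (c * n) → c * u * (n * n) ≤ w * v + 13 * (c * u * n)
scaled-bound {u} {v} {r} {w} {c} {n} {x} u≡xr u≤v+6r w≤cnx cn²≤ = begin
  c * u * (n * n)                            ≡⟨ right-swap c u (n * n) ⟩
  c * (n * n) * u                            ≤⟨ *-monoˡ-≤ u cn²≤ ⟩
  (w + 7 * (c * n)) * u                      ≡⟨ *-distribʳ-+ u w (7 * (c * n)) ⟩
  w * u + 7 * (c * n) * u                    ≤⟨ +-monoˡ-≤ (7 * (c * n) * u) (*-monoʳ-≤ w u≤v+6r) ⟩
  w * (v + 6 * r) + 7 * (c * n) * u          ≡⟨ cong (_+ 7 * (c * n) * u) (spread w v r) ⟩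
  w * v + 6 * (w * r) + 7 * (c * n) * u
    ≤⟨ +-monoˡ-≤ (7 * (c * n) * u) (+-monoʳ-≤ (w * v) (*-monoʳ-≤ 6 wr≤)) ⟩
  w * v + 6 * (c * n * u) + 7 * (c * n) * u  ≡⟨ collect (w * v) c n u ⟩
  w * v + 13 * (c * u * n)                   ∎
  where
  open ≤-Reasoning
  wr≤ : w * r ≤ c * n * u
  wr≤ = ≤-trans (*-monoˡ-≤ r w≤cnx) (≤-reflexive (trans (*-assoc (c * n) x r) (cong (c * n *_) (sym u≡xr))))
  right-swap : ∀ a b c → a * b * c ≡ a * c * b
  right-swap = solve-∀
  spread : ∀ w v r → w * (v + 6 * r) ≡ w * v + 6 * (w * r)
  spread = solve-∀
  collect : ∀ v w n u → v + 6 * (w * n * u) + 7 * (w * n) * u ≡ v + 13 * (w * u * n)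
  collect = solve-∀

module LowerEstimates (p : ℕ) where
  open Estimates (suc p)

  -- Here n = p + 3. The factor (k - j) / (n² - j) decreases in j, and even at the last index j = n
  -- - 1 it is at least (p/(p + 1))² = (1 - 1/(n - 2))². With 1/(n - 1) in place of 1/(n - 2) this
  -- would fail for large n.
  c₀-lower : b * (p * p) ^ n ≤ c₀ * (suc p * suc p) ^ n
  c₀-lower = C-ratio n {k} {n * n} λ {j} j<n → begin
    (n * n ∸ j) * (p * p)
      ≡⟨ *-distribʳ-∸ (p * p) (n * n) j ⟩
    n * n * (p * p) ∸ j * (p * p)
      ≤⟨ ∸-monoˡ-≤ (j * (p * p)) (m+n≤o⇒m≤o∸n (n * n * (p * p)) (bound j (≤-pred j<n))) ⟩
    k * (suc p * suc p) ∸ j * (2 * p + 1) ∸ j * (p * p)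
      ≡⟨ ∸-+-assoc (k * (suc p * suc p)) (j * (2 * p + 1)) (j * (p * p)) ⟩
    k * (suc p * suc p) ∸ (j * (2 * p + 1) + j * (p * p))
      ≡⟨ cong (k * (suc p * suc p) ∸_) (square j p) ⟩
    k * (suc p * suc p) ∸ j * (suc p * suc p)
      ≡⟨ *-distribʳ-∸ (suc p * suc p) k j ⟨
    (k ∸ j) * (suc p * suc p) ∎
    where
    open ≤-Reasoning
    square : ∀ j p → j * (2 * p + 1) + j * (p * p) ≡ j * (suc p * suc p)
    square = solve-∀
    eq : ∀ p → (3 + p) * (3 + p) * (p * p) + (2 + p) * (2 * p + 1) + (1 + 5 * p + p * p) ≡
      suc p * (3 + p) * (suc p * suc p)
    eq = solve-∀
    bound : ∀ j → j ≤ 2 + p → n * n * (p * p) + j * (2 * p + 1) ≤ k * (suc p * suc p)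
    bound j j≤ = ≤-trans (+-monoʳ-≤ (n * n * (p * p)) (*-monoˡ-≤ (2 * p + 1) j≤))
      (≤-from-+ (1 + 5 * p + p * p) (eq p))

  -- The denominator in q s² ≥ (k + 2)(k + 1) p⁶ b / z, for s a partial sum of the exponential
  -- series: (n + 2)(n + 1) comes from `q-absorb`, the sixth power of p + 1 from `c₀-lower`. By
  -- `z-bound` the right side is at least (n² - 13 n) b.
  z : ℕ
  z = (2 + n) * suc n * (suc p * suc p) ^ 3

  z-bound : z * (n * n) ≤ (2 + k) * suc k * (p * p) ^ 3 + 13 * (z * n)
  z-bound = scaled-bound {r = suc p ^ 5} {w = (2 + k) * suc k} {c = (2 + n) * suc n} {n = n} {x = suc p}
    (sixth (suc p)) sixth-≤ smaller leading
    where
    sixth : ∀ a → (a * a) ^ 3 ≡ a ^ 6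
    sixth = expanded
      where
      expanded : ∀ a → (a * a) * ((a * a) * ((a * a) * 1)) ≡ a * (a * (a * (a * (a * (a * 1)))))
      expanded = solve-∀
    sixth-≤ : (suc p * suc p) ^ 3 ≤ (p * p) ^ 3 + 6 * suc p ^ 5
    sixth-≤ = subst₂ (λ u v → u ≤ v + 6 * suc p ^ 5) (sym (sixth (suc p))) (sym (sixth p)) (bernoulli p 5)
    leading-eq : ∀ p → (5 + p) * (4 + p) * ((3 + p) * (3 + p)) + (260 + p * (164 + p * 26)) ≡
      (2 + suc p * (3 + p)) * suc (suc p * (3 + p)) + 7 * ((5 + p) * (4 + p) * (3 + p))
    leading-eq = solve-∀
    leading : (2 + n) * suc n * (n * n) ≤ (2 + k) * suc k + 7 * ((2 + n) * suc n * n)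
    leading = ≤-from-+ _ (leading-eq p)
    smaller-eq : ∀ p → (2 + suc p * (3 + p)) * suc (suc p * (3 + p)) + (40 + p * (71 + p * (34 + p * 5))) ≡ (5 + p) * (4 + p) * (3 + p) * suc p
    smaller-eq = solve-∀
    smaller : (2 + k) * suc k ≤ (2 + n) * suc n * n * suc p
    smaller = ≤-from-+ _ (smaller-eq p)

-- The exponential series

open import Data.Integer using (+_)

ι : ℕ → ℚ
ι m = fromℤ (+ m)

ι-+ : ∀ m n → ι (m + n) ≡ ι m +ℚ ι n
ι-+ m n =
  ℚ.toℚᵘ-injective (ℚᵘ.≃-trans (ℚᵘ.*≡* (cong (ℤ._* + 1) (sym (cong₂ ℤ._+_ (ℤ.*-identityʳ (+ m)) (ℤ.*-identityʳ (+ n))))))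
  (ℚᵘ.≃-sym (ℚ.toℚᵘ-homo-+ (ι m) (ι n))))

ι-* : ∀ m n → ι (m * n) ≡ ι m *ℚ ι n
ι-* m n = ℚ.toℚᵘ-injective (ℚᵘ.≃-trans (ℚᵘ.*≡* (cong (ℤ._* + 1) (ℤ.pos-* m n)))
  (ℚᵘ.≃-sym (ℚ.toℚᵘ-homo-* (ι m) (ι n))))

ι-mono-≤ : ∀ {m n} → m ≤ n → ι m ≤ℚ ι n
ι-mono-≤ m≤n = ℚ.*≤* (ℤ.*-monoʳ-≤-nonNeg (+ 1) (ℤ.+≤+ m≤n))

0≤ι : ∀ m → 0ℚ ≤ℚ ι m
0≤ι m = ι-mono-≤ z≤n

0<ι : ∀ m .{{_ : NonZero m}} → 0ℚ <ℚ ι m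
0<ι (suc m) = ℚ.positive⁻¹ (ι (suc m))

/-*-ι : ∀ a b .{{_ : NonZero b}} → (+ a / b) *ℚ ι b ≡ ι a
/-*-ι a (suc b) = ℚ.toℚᵘ-injective (begin
  ℚ.toℚᵘ ((+ a / suc b) *ℚ ι (suc b))              ≈⟨ ℚ.toℚᵘ-homo-* (+ a / suc b) (ι (suc b)) ⟩
  ℚ.toℚᵘ (+ a / suc b) ℚᵘ.* ℚ.toℚᵘ (ι (suc b))
    ≈⟨ ℚᵘ.*-congʳ {ℚ.toℚᵘ (ι (suc b))} (ℚ.toℚᵘ-fromℚᵘ (ℚᵘ.mkℚᵘ (+ a) b)) ⟩
  ℚᵘ.mkℚᵘ (+ a) b ℚᵘ.* ℚ.toℚᵘ (ι (suc b))
    ≈⟨ ℚᵘ.*≡* (trans (ℤ.*-identityʳ _) (cong (+ a ℤ.*_) (cong +_ (sym (*-identityʳ (suc b)))))) ⟩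
  ℚ.toℚᵘ (ι a)                                     ∎)
  where open ℚᵘ.≃-Reasoning

*-mono-≤ˡ : ∀ {p q r} → 0ℚ ≤ℚ r → p ≤ℚ q → r *ℚ p ≤ℚ r *ℚ q
*-mono-≤ˡ {r = r} 0≤r = ℚ.*-monoˡ-≤-nonNeg r {{nonNegative 0≤r}}

*-mono-≤ʳ : ∀ {p q r} → 0ℚ ≤ℚ r → p ≤ℚ q → p *ℚ r ≤ℚ q *ℚ r
*-mono-≤ʳ {r = r} 0≤r = ℚ.*-monoʳ-≤-nonNeg r {{nonNegative 0≤r}}

*-cancel-≤ˡ : ∀ {p q r} → 0ℚ <ℚ r → r *ℚ p ≤ℚ r *ℚ q → p ≤ℚ q
*-cancel-≤ˡ {r = r} 0<r = ℚ.*-cancelˡ-≤-pos r {{positive 0<r}}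

*-cancelˡ : ∀ {p q r} → 0ℚ <ℚ r → r *ℚ p ≡ r *ℚ q → p ≡ q
*-cancelˡ 0<r eq = ℚ.≤-antisym (*-cancel-≤ˡ 0<r (ℚ.≤-reflexive eq)) (*-cancel-≤ˡ 0<r (ℚ.≤-reflexive (sym eq)))

0≤* : ∀ {p q} → 0ℚ ≤ℚ p → 0ℚ ≤ℚ q → 0ℚ ≤ℚ p *ℚ q
0≤* {p} {q} 0≤p 0≤q = subst (_≤ℚ p *ℚ q) (ℚ.*-zeroʳ p) (*-mono-≤ˡ 0≤p 0≤q)

0≤+ : ∀ {p q} → 0ℚ ≤ℚ p → 0ℚ ≤ℚ q → 0ℚ ≤ℚ p +ℚ q
0≤+ = ℚ.+-mono-≤

p≤p+q : ∀ {p q} → 0ℚ ≤ℚ q → p ≤ℚ p +ℚ q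
p≤p+q {p} {q} 0≤q = subst (_≤ℚ p +ℚ q) (ℚ.+-identityʳ p) (ℚ.+-monoʳ-≤ p 0≤q)

expTerm : ℕ → ℚ → ℚ
expTerm zero    x = 1ℚ
expTerm (suc j) x = expTerm j x *ℚ x *ℚ (+ 1 / suc j)

-- A variable x is needed because s_k, the value at 1, is reached from the value 1 at 0 in m steps
-- of length 1/m.
expPoly : ℕ → ℚ → ℚ
expPoly zero    x = expTerm 0 x
expPoly (suc k) x = expPoly k x +ℚ expTerm (suc k) x

expTerm-suc : ∀ j x → ι (suc j) *ℚ expTerm (suc j) x ≡ expTerm j x *ℚ x
expTerm-suc j x = begin
  ι (suc j) *ℚ (expTerm j x *ℚ x *ℚ r)
    ≡⟨ solve 3 (λ a t r → a :* (t :* r) := t :* (r :* a)) refl (ι (suc j)) (expTerm j x *ℚ x) r ⟩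
  expTerm j x *ℚ x *ℚ (r *ℚ ι (suc j))  ≡⟨ cong (expTerm j x *ℚ x *ℚ_) (/-*-ι 1 (suc j)) ⟩
  expTerm j x *ℚ x *ℚ 1ℚ                ≡⟨ ℚ.*-identityʳ _ ⟩
  expTerm j x *ℚ x                      ∎
  where
  open ≡-Reasoning
  r = + 1 / suc j

inv!-* : ∀ k → inv! k *ℚ ι (k !) ≡ 1ℚ
inv!-* k = /-*-ι 1 (k !) {{k !≢0}}

expTerm-1 : ∀ j → expTerm j 1ℚ ≡ inv! j
expTerm-1 zero    = refl
expTerm-1 (suc j) = *-cancelˡ (0<ι (suc j)) (trans (expTerm-suc j 1ℚ) (trans (ℚ.*-identityʳ (expTerm j 1ℚ))
  (trans (expTerm-1 j) (*-cancelˡ (0<ι (j !) {{j !≢0}}) (begin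
    ι (j !) *ℚ inv! j                          ≡⟨ ℚ.*-comm (ι (j !)) (inv! j) ⟩
    inv! j *ℚ ι (j !)                          ≡⟨ inv!-* j ⟩
    1ℚ                                         ≡⟨ inv!-* (suc j) ⟨
    inv! (suc j) *ℚ ι (suc j * j !)            ≡⟨ cong (inv! (suc j) *ℚ_) (ι-* (suc j) (j !)) ⟩
    inv! (suc j) *ℚ (ι (suc j) *ℚ ι (j !))
      ≡⟨ solve 3 (λ i a b → i :* (a :* b) := b :* (a :* i)) refl (inv! (suc j)) (ι (suc j)) (ι (j !)) ⟩
    ι (j !) *ℚ (ι (suc j) *ℚ inv! (suc j))     ∎)))))
  where open ≡-Reasoning

expPoly-1 : ∀ k → expPoly k 1ℚ ≡ expSum k
expPoly-1 zero    = refl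
expPoly-1 (suc k) = cong₂ _+ℚ_ (expPoly-1 k) (expTerm-1 (suc k))

expPoly-0 : ∀ k → expPoly k 0ℚ ≡ 1ℚ
expPoly-0 zero    = refl
expPoly-0 (suc k) = cong₂ _+ℚ_ (expPoly-0 k)
  (trans (cong (_*ℚ (+ 1 / suc k)) (ℚ.*-zeroʳ (expTerm k 0ℚ))) (ℚ.*-zeroˡ (+ 1 / suc k)))

0≤expTerm : ∀ j {x} → 0ℚ ≤ℚ x → 0ℚ ≤ℚ expTerm j x
0≤expTerm zero    0≤x = 0≤ι 1
0≤expTerm (suc j) 0≤x =
  *-cancel-≤ˡ (0<ι (suc j)) (subst₂ _≤ℚ_ (sym (ℚ.*-zeroʳ (ι (suc j)))) (sym (expTerm-suc j _))
  (0≤* (0≤expTerm j 0≤x) 0≤x))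

expPoly-mono : ∀ {x} → 0ℚ ≤ℚ x → ∀ {k l} → k ≤ l → expPoly k x ≤ℚ expPoly l x
expPoly-mono {x} 0≤x {k} {l} k≤l = subst (λ o → expPoly k x ≤ℚ expPoly o x) (m∸n+n≡m k≤l) (go (l ∸ k))
  where
  go : ∀ d → expPoly k x ≤ℚ expPoly (d + k) x
  go zero    = ℚ.≤-refl
  go (suc d) = ℚ.≤-trans (go d) (p≤p+q (0≤expTerm (suc (d + k)) 0≤x))

1≤expPoly : ∀ k {x} → 0ℚ ≤ℚ x → 1ℚ ≤ℚ expPoly k x
1≤expPoly k 0≤x = expPoly-mono 0≤x {0} {k} z≤n

-- The mean value theorem for x^j / j!, whose derivative is x^(j-1) / (j-1)!.
module MeanValue {x h : ℚ} (0≤x : 0ℚ ≤ℚ x) (0≤h : 0ℚ ≤ℚ h) where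

  private
    y = x +ℚ h
    0≤y : 0ℚ ≤ℚ y
    0≤y = 0≤+ 0≤x 0≤h
    open ℚ.≤-Reasoning

    ι-suc : ∀ j → ι (suc j) ≡ 1ℚ +ℚ ι j
    ι-suc = ι-+ 1

  expTerm-upper : ∀ j → expTerm (suc j) y ≤ℚ expTerm (suc j) x +ℚ h *ℚ expTerm j y
  expTerm-upper zero    =
    ℚ.≤-reflexive (solve 2 (λ x h → con 1ℚ :* (x :+ h) :* con 1ℚ := con 1ℚ :* x :* con 1ℚ :+ h :* con 1ℚ) refl x h)
  expTerm-upper (suc i) = *-cancel-≤ˡ (0<ι (2 + i)) (begin
    ι (2 + i) *ℚ expTerm (2 + i) y
      ≡⟨ expTerm-suc (suc i) y ⟩
    t *ℚ (x +ℚ h)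
      ≡⟨ ℚ.*-distribˡ-+ t x h ⟩
    t *ℚ x +ℚ t *ℚ h
      ≤⟨ ℚ.+-monoˡ-≤ (t *ℚ h) (*-mono-≤ʳ 0≤x (expTerm-upper i)) ⟩
    (t₀ +ℚ h *ℚ s) *ℚ x +ℚ t *ℚ h
      -- The added h² s completes h s x to h s y, to which the recursion for `expTerm` applies.
      ≤⟨ p≤p+q (0≤* (0≤* 0≤h 0≤h) (0≤expTerm i 0≤y)) ⟩
    (t₀ +ℚ h *ℚ s) *ℚ x +ℚ t *ℚ h +ℚ h *ℚ h *ℚ s
      ≡⟨ solve 5 (λ t₀ h s x t → (t₀ :+ h :* s) :* x :+ t :* h :+ h :* h :* s := t₀ :* x :+ h :* (t :+ s :* (x :+ h)))
           refl t₀ h s x t ⟩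
    t₀ *ℚ x +ℚ h *ℚ (t +ℚ s *ℚ y)
      ≡⟨ cong₂ (λ a b → a +ℚ h *ℚ (t +ℚ b)) (sym (expTerm-suc (suc i) x)) (sym (expTerm-suc i y)) ⟩
    ι (2 + i) *ℚ expTerm (2 + i) x +ℚ h *ℚ (t +ℚ ι (suc i) *ℚ t)
      ≡⟨ solve 5 (λ a e h t b → a :* e :+ h :* (t :+ b :* t) := a :* e :+ (con 1ℚ :+ b) :* (h :* t))
           refl (ι (2 + i)) (expTerm (2 + i) x) h t (ι (suc i)) ⟩
    ι (2 + i) *ℚ expTerm (2 + i) x +ℚ (1ℚ +ℚ ι (suc i)) *ℚ (h *ℚ t)
      ≡⟨ cong (λ a → ι (2 + i) *ℚ expTerm (2 + i) x +ℚ a *ℚ (h *ℚ t)) (ι-suc (suc i)) ⟨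
    ι (2 + i) *ℚ expTerm (2 + i) x +ℚ ι (2 + i) *ℚ (h *ℚ t)
      ≡⟨ ℚ.*-distribˡ-+ (ι (2 + i)) (expTerm (2 + i) x) (h *ℚ t) ⟨
    ι (2 + i) *ℚ (expTerm (2 + i) x +ℚ h *ℚ t) ∎)
    where
    t = expTerm (suc i) y
    t₀ = expTerm (suc i) x
    s = expTerm i y

  expTerm-lower : ∀ j → expTerm (suc j) x +ℚ h *ℚ expTerm j x ≤ℚ expTerm (suc j) y
  expTerm-lower zero    =
    ℚ.≤-reflexive (solve 2 (λ x h → con 1ℚ :* x :* con 1ℚ :+ h :* con 1ℚ := con 1ℚ :* (x :+ h) :* con 1ℚ) refl x h)
  expTerm-lower (suc i) = *-cancel-≤ˡ (0<ι (2 + i)) (begin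
    ι (2 + i) *ℚ (expTerm (2 + i) x +ℚ h *ℚ t)
      ≡⟨ ℚ.*-distribˡ-+ (ι (2 + i)) (expTerm (2 + i) x) (h *ℚ t) ⟩
    ι (2 + i) *ℚ expTerm (2 + i) x +ℚ ι (2 + i) *ℚ (h *ℚ t)
      ≡⟨ cong₂ (λ a b → a +ℚ b *ℚ (h *ℚ t)) (expTerm-suc (suc i) x) (ι-suc (suc i)) ⟩
    t *ℚ x +ℚ (1ℚ +ℚ ι (suc i)) *ℚ (h *ℚ t)
      ≡⟨ solve 4 (λ t x h b → t :* x :+ (con 1ℚ :+ b) :* (h :* t) := t :* x :+ h :* (b :* t) :+ t :* h)
           refl t x h (ι (suc i)) ⟩
    t *ℚ x +ℚ h *ℚ (ι (suc i) *ℚ t) +ℚ t *ℚ h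
      ≡⟨ cong (λ a → t *ℚ x +ℚ h *ℚ a +ℚ t *ℚ h) (expTerm-suc i x) ⟩
    t *ℚ x +ℚ h *ℚ (s *ℚ x) +ℚ t *ℚ h
      ≡⟨ solve 4 (λ t x h s → t :* x :+ h :* (s :* x) :+ t :* h := (t :+ h :* s) :* x :+ t :* h) refl t x h s ⟩
    (t +ℚ h *ℚ s) *ℚ x +ℚ t *ℚ h
      ≤⟨ ℚ.+-mono-≤ (*-mono-≤ʳ 0≤x (expTerm-lower i)) (*-mono-≤ʳ 0≤h (ℚ.≤-trans (p≤p+q {t} (0≤* 0≤h (0≤expTerm i 0≤x))) (expTerm-lower i))) ⟩
    t₁ *ℚ x +ℚ t₁ *ℚ h
      ≡⟨ ℚ.*-distribˡ-+ t₁ x h ⟨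
    t₁ *ℚ y
      ≡⟨ expTerm-suc (suc i) y ⟨
    ι (2 + i) *ℚ expTerm (2 + i) y ∎)
    where
    t = expTerm (suc i) x
    t₁ = expTerm (suc i) y
    s = expTerm i x

  private
    regroup : ∀ a b c d → (a +ℚ b) +ℚ (c +ℚ d) ≡ (a +ℚ c) +ℚ (b +ℚ d)
    regroup = solve 4 (λ a b c d → (a :+ b) :+ (c :+ d) := (a :+ c) :+ (b :+ d)) refl

    expPoly-upper′ : ∀ k → expPoly (suc k) y ≤ℚ expPoly (suc k) x +ℚ h *ℚ expPoly k y
    expPoly-upper′ zero    =
      ℚ.≤-trans (ℚ.+-monoʳ-≤ 1ℚ (expTerm-upper 0)) (ℚ.≤-reflexive (sym (ℚ.+-assoc 1ℚ (expTerm 1 x) (h *ℚ 1ℚ))))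
    expPoly-upper′ (suc k) = ℚ.≤-trans (ℚ.+-mono-≤ (expPoly-upper′ k) (expTerm-upper (suc k)))
      (ℚ.≤-reflexive (trans (regroup (expPoly (suc k) x) (h *ℚ expPoly k y) (expTerm (2 + k) x) (h *ℚ expTerm (suc k) y))
        (cong (expPoly (2 + k) x +ℚ_) (sym (ℚ.*-distribˡ-+ h (expPoly k y) (expTerm (suc k) y))))))

  expPoly-upper : ∀ k → expPoly k y ≤ℚ expPoly k x +ℚ h *ℚ expPoly k y
  expPoly-upper zero    = p≤p+q (0≤* 0≤h (0≤ι 1))
  expPoly-upper (suc k) = ℚ.≤-trans (expPoly-upper′ k)
    (ℚ.+-monoʳ-≤ (expPoly (suc k) x) (*-mono-≤ˡ 0≤h (p≤p+q (0≤expTerm (suc k) 0≤y))))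

  -- The derivative of `expPoly (suc k)` is `expPoly k`, so from below each step costs one degree.
  -- This is why `expSum-lower` asks for `suc l ≤ k`.
  expPoly-lower : ∀ k → expPoly k x +ℚ h *ℚ expPoly k x ≤ℚ expPoly (suc k) y
  expPoly-lower k =
    ℚ.≤-trans (ℚ.+-monoˡ-≤ (h *ℚ expPoly k x) (p≤p+q {expPoly k x} (0≤expTerm (suc k) 0≤x))) (go k)
    where
    go : ∀ k → expPoly (suc k) x +ℚ h *ℚ expPoly k x ≤ℚ expPoly (suc k) y
    go zero    =
      ℚ.≤-trans (ℚ.≤-reflexive (ℚ.+-assoc 1ℚ (expTerm 1 x) (h *ℚ 1ℚ))) (ℚ.+-monoʳ-≤ 1ℚ (expTerm-lower 0))
    go (suc k) =
      ℚ.≤-trans (ℚ.≤-reflexive (trans (cong (expPoly (2 + k) x +ℚ_) (ℚ.*-distribˡ-+ h (expPoly k x) (expTerm (suc k) x)))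
        (regroup (expPoly (suc k) x) (expTerm (2 + k) x) (h *ℚ expPoly k x) (h *ℚ expTerm (suc k) x))))
      (ℚ.+-mono-≤ (go k) (expTerm-lower (suc k)))

-- Partial sums of the series against powers of 1 + 1/m

module _ (l : ℕ) where

  private
    m = suc l
    h = + 1 / m
    hm≡1 : h *ℚ ι m ≡ 1ℚ
    hm≡1 = /-*-ι 1 m
    0≤h : 0ℚ ≤ℚ h
    0≤h =
      *-cancel-≤ˡ (0<ι m) (subst₂ _≤ℚ_ (sym (ℚ.*-zeroʳ (ι m))) (sym (trans (ℚ.*-comm (ι m) h) hm≡1)) (0≤ι 1))
    pt : ℕ → ℚ
    pt i = ι i *ℚ h
    0≤pt : ∀ i → 0ℚ ≤ℚ pt i
    0≤pt i = 0≤* (0≤ι i) 0≤h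
    pt-suc : ∀ i → pt (suc i) ≡ pt i +ℚ h
    pt-suc i = trans (cong (_*ℚ h) (ι-+ 1 i)) (solve 2 (λ a h → (con 1ℚ :+ a) :* h := a :* h :+ h) refl (ι i) h)
    pt-m : pt m ≡ 1ℚ
    pt-m = trans (ℚ.*-comm (ι m) h) hm≡1
    open ℚ.≤-Reasoning

    -- A step of length h = 1/m multiplies the value by at most 1/(1 - h) = m/l.
    upper : ∀ k i → expPoly k (pt i) *ℚ ι (l ^ i) ≤ℚ ι (m ^ i)
    upper k zero    =
      ℚ.≤-reflexive (trans (ℚ.*-identityʳ _) (trans (cong (expPoly k) (ℚ.*-zeroˡ h)) (expPoly-0 k)))
    upper k (suc i) = begin
      E′ *ℚ ι (l * l ^ i)                ≡⟨ cong (E′ *ℚ_) (ι-* l (l ^ i)) ⟩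
      E′ *ℚ (ι l *ℚ ι (l ^ i))
        ≡⟨ solve 3 (λ e a b → e :* (a :* b) := a :* e :* b) refl E′ (ι l) (ι (l ^ i)) ⟩
      ι l *ℚ E′ *ℚ ι (l ^ i)             ≤⟨ *-mono-≤ʳ (0≤ι (l ^ i)) step ⟩
      ι m *ℚ E *ℚ ι (l ^ i)              ≡⟨ ℚ.*-assoc (ι m) E (ι (l ^ i)) ⟩
      ι m *ℚ (E *ℚ ι (l ^ i))            ≤⟨ *-mono-≤ˡ (0≤ι m) (upper k i) ⟩
      ι m *ℚ ι (m ^ i)                   ≡⟨ ι-* m (m ^ i) ⟨
      ι (m ^ suc i)                      ∎
      where
      E = expPoly k (pt i)
      E′ = expPoly k (pt (suc i))
      mean : E′ ≤ℚ E +ℚ h *ℚ E′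
      mean =
        subst (λ y → expPoly k y ≤ℚ E +ℚ h *ℚ expPoly k y) (sym (pt-suc i)) (MeanValue.expPoly-upper (0≤pt i) 0≤h k)
      step : ι l *ℚ E′ ≤ℚ ι m *ℚ E
      step = begin
        ι l *ℚ E′
          ≡⟨ solve 2 (λ a e → a :* e := (con 1ℚ :+ a) :* e :- e) refl (ι l) E′ ⟩
        (1ℚ +ℚ ι l) *ℚ E′ -ℚ E′                  ≡⟨ cong (λ a → a *ℚ E′ -ℚ E′) (ι-+ 1 l) ⟨
        ι m *ℚ E′ -ℚ E′                          ≤⟨ ℚ.+-monoˡ-≤ (-ℚ E′) (*-mono-≤ˡ (0≤ι m) mean) ⟩
        ι m *ℚ (E +ℚ h *ℚ E′) -ℚ E′
          ≡⟨ solve 4 (λ a e h e′ → a :* (e :+ h :* e′) :- e′ := a :* e :+ (h :* a) :* e′ :- e′)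
               refl (ι m) E h E′ ⟩
        ι m *ℚ E +ℚ h *ℚ ι m *ℚ E′ -ℚ E′         ≡⟨ cong (λ a → ι m *ℚ E +ℚ a *ℚ E′ -ℚ E′) hm≡1 ⟩
        ι m *ℚ E +ℚ 1ℚ *ℚ E′ -ℚ E′
          ≡⟨ solve 2 (λ a e → a :+ con 1ℚ :* e :- e := a) refl (ι m *ℚ E) E′ ⟩
        ι m *ℚ E                                 ∎

    -- A step multiplies the value by at least 1 + h = (m + 1)/m, while the degree grows with the
    -- number of steps.
    lower : ∀ i → ι (suc m ^ i) ≤ℚ expPoly i (pt i) *ℚ ι (m ^ i)
    lower zero    = ℚ.≤-refl
    lower (suc i) = begin
      ι (suc m * suc m ^ i)              ≡⟨ ι-* (suc m) (suc m ^ i) ⟩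
      ι (suc m) *ℚ ι (suc m ^ i)         ≤⟨ *-mono-≤ˡ (0≤ι (suc m)) (lower i) ⟩
      ι (suc m) *ℚ (E *ℚ ι (m ^ i))      ≡⟨ ℚ.*-assoc (ι (suc m)) E (ι (m ^ i)) ⟨
      ι (suc m) *ℚ E *ℚ ι (m ^ i)        ≤⟨ *-mono-≤ʳ (0≤ι (m ^ i)) step ⟩
      ι m *ℚ E′ *ℚ ι (m ^ i)
        ≡⟨ solve 3 (λ e a b → a :* e :* b := e :* (a :* b)) refl E′ (ι m) (ι (m ^ i)) ⟩
      E′ *ℚ (ι m *ℚ ι (m ^ i))           ≡⟨ cong (E′ *ℚ_) (ι-* m (m ^ i)) ⟨
      E′ *ℚ ι (m ^ suc i)                ∎
      where
      E = expPoly i (pt i)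
      E′ = expPoly (suc i) (pt (suc i))
      mean : E +ℚ h *ℚ E ≤ℚ E′
      mean =
        subst (λ y → E +ℚ h *ℚ E ≤ℚ expPoly (suc i) y) (sym (pt-suc i)) (MeanValue.expPoly-lower (0≤pt i) 0≤h i)
      step : ι (suc m) *ℚ E ≤ℚ ι m *ℚ E′
      step = begin
        ι (suc m) *ℚ E               ≡⟨ cong (_*ℚ E) (ι-+ 1 m) ⟩
        (1ℚ +ℚ ι m) *ℚ E             ≡⟨ cong (λ a → (a +ℚ ι m) *ℚ E) hm≡1 ⟨
        (h *ℚ ι m +ℚ ι m) *ℚ E
          ≡⟨ solve 3 (λ h a e → (h :* a :+ a) :* e := a :* (e :+ h :* e)) refl h (ι m) E ⟩
        ι m *ℚ (E +ℚ h *ℚ E)         ≤⟨ *-mono-≤ˡ (0≤ι m) mean ⟩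
        ι m *ℚ E′                    ∎

  expSum-upper : ∀ k → expSum k *ℚ ι (l ^ suc l) ≤ℚ ι (suc l ^ suc l)
  expSum-upper k =
    subst (λ s → s *ℚ ι (l ^ m) ≤ℚ ι (m ^ m)) (trans (cong (expPoly k) pt-m) (expPoly-1 k)) (upper k m)

  expSum-lower : ∀ {k} → suc l ≤ k → ι ((2 + l) ^ suc l) ≤ℚ expSum k *ℚ ι (suc l ^ suc l)
  expSum-lower {k} m≤k = ℚ.≤-trans (lower m) (*-mono-≤ʳ (0≤ι (m ^ m)) (begin
    expPoly m (pt m)  ≡⟨ cong (expPoly m) pt-m ⟩
    expPoly m 1ℚ      ≤⟨ expPoly-mono (0≤ι 1) m≤k ⟩
    expPoly k 1ℚ      ≡⟨ expPoly-1 k ⟩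
    expSum k          ∎))

1≤expSum : ∀ k → 1ℚ ≤ℚ expSum k
1≤expSum k = subst (1ℚ ≤ℚ_) (expPoly-1 k) (1≤expPoly k (0≤ι 1))

expSum≤4 : ∀ k → expSum k ≤ℚ ι 4
expSum≤4 k = ℚ.≤-trans (ℚ.≤-reflexive (sym (ℚ.*-identityʳ (expSum k)))) (expSum-upper 1 k)

-- The limit

*-mono-≤ℚ : ∀ {x y x′ y′} → 0ℚ ≤ℚ x → 0ℚ ≤ℚ y′ → x ≤ℚ x′ → y ≤ℚ y′ → x *ℚ y ≤ℚ x′ *ℚ y′
*-mono-≤ℚ 0≤x 0≤y′ x≤ y≤ = ℚ.≤-trans (*-mono-≤ˡ 0≤x y≤) (*-mono-≤ʳ 0≤y′ x≤)

module _ {x y n d q s : ℚ} (0<d : 0ℚ <ℚ d) (0≤y : 0ℚ ≤ℚ y) (x*nd≡s : x *ℚ (n *ℚ d) ≡ s) where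

  private
    open ℚ.≤-Reasoning
    scaled : d *ℚ (x *ℚ y *ℚ n) ≡ s *ℚ y
    scaled =
      trans (solve 4 (λ d x y n → d :* (x :* y :* n) := x :* (n :* d) :* y) refl d x y n) (cong (_*ℚ y) x*nd≡s)

  -- To be read with x = μ_n, y = s_k², d = n C(n², n) and s the total number of safe spaces. The
  -- error 8 d y is at most 8 * 16 d, whence 128; 16 is the square of the bound 4 for s_k.
  ratio-upper : y ≤ℚ ι 16 → s ≤ℚ ι 2 *ℚ q +ℚ ι 8 *ℚ d → q *ℚ y ≤ℚ n *ℚ d → x *ℚ y *ℚ n ≤ℚ ι 2 *ℚ n +ℚ ι 128
  ratio-upper y≤16 s≤ qy≤nd = *-cancel-≤ˡ 0<d (begin
    d *ℚ (x *ℚ y *ℚ n)                        ≡⟨ scaled ⟩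
    s *ℚ y                                    ≤⟨ *-mono-≤ʳ 0≤y s≤ ⟩
    (ι 2 *ℚ q +ℚ ι 8 *ℚ d) *ℚ y
      ≡⟨ solve 5 (λ t q e d y → (t :* q :+ e :* d) :* y := t :* (q :* y) :+ (e :* d) :* y)
           refl (ι 2) q (ι 8) d y ⟩
    ι 2 *ℚ (q *ℚ y) +ℚ ι 8 *ℚ d *ℚ y
      ≤⟨ ℚ.+-mono-≤ (*-mono-≤ˡ (0≤ι 2) qy≤nd) (*-mono-≤ˡ (0≤* (0≤ι 8) (ℚ.<⇒≤ 0<d)) y≤16) ⟩
    ι 2 *ℚ (n *ℚ d) +ℚ ι 8 *ℚ d *ℚ ι 16
      ≡⟨ solve 2 (λ n d → con (ι 2) :* (n :* d) :+ con (ι 8) :* d :* con (ι 16) := d :* (con (ι 2) :* n :+ con (ι 128)))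
           refl n d ⟩
    d *ℚ (ι 2 *ℚ n +ℚ ι 128)                  ∎)

  -- The error is 2 * 13 = 26 units, weakened to the 128 of `ratio-upper` so that one constant
  -- serves both sides.
  ratio-lower : ι 2 *ℚ q ≤ℚ s → n *ℚ d ≤ℚ q *ℚ y +ℚ ι 13 *ℚ d → ι 2 *ℚ n ≤ℚ x *ℚ y *ℚ n +ℚ ι 128
  ratio-lower 2q≤s nd≤ = *-cancel-≤ˡ 0<d (begin
    d *ℚ (ι 2 *ℚ n)
      ≡⟨ solve 3 (λ d t n → d :* (t :* n) := t :* (n :* d)) refl d (ι 2) n ⟩
    ι 2 *ℚ (n *ℚ d)                           ≤⟨ *-mono-≤ˡ (0≤ι 2) nd≤ ⟩
    ι 2 *ℚ (q *ℚ y +ℚ ι 13 *ℚ d)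
      ≡⟨ solve 3 (λ q y d → con (ι 2) :* (q :* y :+ con (ι 13) :* d) := con (ι 2) :* q :* y :+ con (ι 26) :* d)
           refl q y d ⟩
    ι 2 *ℚ q *ℚ y +ℚ ι 26 *ℚ d
      ≤⟨ ℚ.+-mono-≤ (*-mono-≤ʳ 0≤y 2q≤s) (*-mono-≤ʳ (ℚ.<⇒≤ 0<d) (ι-mono-≤ (m≤m+n 26 102))) ⟩
    s *ℚ y +ℚ ι 128 *ℚ d                      ≡⟨ cong₂ _+ℚ_ (sym scaled) (ℚ.*-comm (ι 128) d) ⟩
    d *ℚ (x *ℚ y *ℚ n) +ℚ d *ℚ ι 128          ≡⟨ ℚ.*-distribˡ-+ d (x *ℚ y *ℚ n) (ι 128) ⟨
    d *ℚ (x *ℚ y *ℚ n +ℚ ι 128)               ∎)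

∣p∣≤ : ∀ {p q} → p ≤ℚ q → -ℚ p ≤ℚ q → ∣ p ∣ℚ ≤ℚ q
∣p∣≤ {p} p≤q -p≤q with ℚ.∣p∣≡p∨∣p∣≡-p p
... | inj₁ eq = subst (_≤ℚ _) (sym eq) p≤q
... | inj₂ eq = subst (_≤ℚ _) (sym eq) -p≤q

distance-≤ : ∀ {x t n c η} → 0ℚ <ℚ n → x *ℚ n ≤ℚ t *ℚ n +ℚ c → t *ℚ n ≤ℚ x *ℚ n +ℚ c → c ≤ℚ n *ℚ η →
  ∣ x -ℚ t ∣ℚ ≤ℚ η
distance-≤ {x} {t} {n} {c} {η} 0<n upper lower c≤ = ∣p∣≤
  (*-cancel-≤ˡ 0<n (begin
    n *ℚ (x -ℚ t)                   ≡⟨ solve 3 (λ n x t → n :* (x :- t) := x :* n :- t :* n) refl n x t ⟩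
    x *ℚ n -ℚ t *ℚ n                ≤⟨ ℚ.+-monoˡ-≤ (-ℚ (t *ℚ n)) upper ⟩
    t *ℚ n +ℚ c -ℚ t *ℚ n           ≡⟨ solve 2 (λ a c → a :+ c :- a := c) refl (t *ℚ n) c ⟩
    c                               ≤⟨ c≤ ⟩
    n *ℚ η                          ∎))
  (*-cancel-≤ˡ 0<n (begin
    n *ℚ -ℚ (x -ℚ t)                ≡⟨ solve 3 (λ n x t → n :* (:- (x :- t)) := t :* n :- x :* n) refl n x t ⟩
    t *ℚ n -ℚ x *ℚ n                ≤⟨ ℚ.+-monoˡ-≤ (-ℚ (x *ℚ n)) lower ⟩
    x *ℚ n +ℚ c -ℚ x *ℚ n           ≡⟨ solve 2 (λ a c → a :+ c :- a := c) refl (x *ℚ n) c ⟩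
    c                               ≤⟨ c≤ ⟩
    n *ℚ η                          ∎))
  where open ℚ.≤-Reasoning

mean-total : ∀ n {c : ℕ} .{{_ : NonZero n}} .{{_ : NonZero c}} → length (configurations n) ≡ c →
  μ n *ℚ (ι n *ℚ ι (n * c)) ≡ ι (totalSafe n)
mean-total n {c} len≡c = begin
  E *ℚ r *ℚ (ι n *ℚ ι (n * c))        ≡⟨ cong (λ d → E *ℚ r *ℚ (ι n *ℚ d)) (ι-* n c) ⟩
  E *ℚ r *ℚ (ι n *ℚ (ι n *ℚ ι c))
    ≡⟨ solve 4 (λ e r a c → e :* r :* (a :* (a :* c)) := (e :* c) :* (r :* (a :* a))) refl E r (ι n) (ι c) ⟩
  E *ℚ ι c *ℚ (r *ℚ (ι n *ℚ ι n))     ≡⟨ cong₂ (λ c d → E *ℚ ι c *ℚ (r *ℚ d)) (sym len≡c) (sym (ι-* n n)) ⟩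
  E *ℚ ι (length (configurations n)) *ℚ (r *ℚ ι (n * n))
    ≡⟨ cong₂ _*ℚ_ (/-*-ι (totalSafe n) (length (configurations n)) {{configurations-nonEmpty n}}) (/-*-ι 1 (n * n) {{m*n≢0 n n}}) ⟩
  ι (totalSafe n) *ℚ 1ℚ               ≡⟨ ℚ.*-identityʳ (ι (totalSafe n)) ⟩
  ι (totalSafe n)                     ∎
  where
  open ≡-Reasoning
  E = expectedSafe n
  r = (+ 1 / (n * n)) {{m*n≢0 n n}}

-- Two-sided bounds for μ_n s_k²

module Asymptotics (l : ℕ) {j : ℕ} (l<j : l < j) where

  private
    -- The side is n = p + 3 = l + 4. As p is a successor, `expSum-lower` applies with exponent p,
    -- and `l<j` is its hypothesis.
    p = suc l
    open Estimates (suc p)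
    open LowerEstimates p
    open ℚ.≤-Reasoning
    s = expSum j
    s² = s *ℚ s
    D = ι (n * b)

    0≤s : 0ℚ ≤ℚ s
    0≤s = ℚ.≤-trans (0≤ι 1) (1≤expSum j)
    0≤s² : 0ℚ ≤ℚ s²
    0≤s² = 0≤* 0≤s 0≤s

    b≢0 : NonZero b
    b≢0 = subst NonZero (length-subsetsOfSize (n * n) n) (configurations-nonEmpty n)

    ι-square-^ : ∀ a e → ι ((a * a) ^ e) ≡ ι (a ^ e) *ℚ ι (a ^ e)
    ι-square-^ a e = trans (cong ι (^-distrib-* a a e)) (ι-* (a ^ e) (a ^ e))

    -- The square of s (n - 1)^n ≤ n^n cancels the factor (1 - 1/n)^(2n) of `q-upper`.
    qs²-upper : ι q *ℚ s² ≤ℚ ι n *ℚ D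
    qs²-upper = *-cancel-≤ˡ (0<ι P {{m^n≢0 (suc (suc p) * suc (suc p)) n}}) (begin
      ι P *ℚ (ι q *ℚ s²)               ≡⟨ cong (_*ℚ (ι q *ℚ s²)) (ι-square-^ (suc (suc p)) n) ⟩
      a *ℚ a *ℚ (ι q *ℚ (s *ℚ s))
        ≡⟨ solve 3 (λ a q s → a :* a :* (q :* (s :* s)) := q :* ((s :* a) :* (s :* a))) refl a (ι q) s ⟩
      ι q *ℚ ((s *ℚ a) *ℚ (s *ℚ a))
        ≤⟨ *-mono-≤ˡ (0≤ι q) (*-mono-≤ℚ (0≤* 0≤s (0≤ι (suc (suc p) ^ n))) (0≤ι (n ^ n)) sa≤ sa≤) ⟩
      ι q *ℚ (ι (n ^ n) *ℚ ι (n ^ n))  ≡⟨ cong (ι q *ℚ_) (ι-square-^ n n) ⟨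
      ι q *ℚ ι ((n * n) ^ n)           ≡⟨ ι-* q ((n * n) ^ n) ⟨
      ι (q * (n * n) ^ n)              ≤⟨ ι-mono-≤ q-upper ⟩
      ι (n * (n * b) * P)              ≡⟨ ι-* (n * (n * b)) P ⟩
      ι (n * (n * b)) *ℚ ι P           ≡⟨ ℚ.*-comm (ι (n * (n * b))) (ι P) ⟩
      ι P *ℚ ι (n * (n * b))           ≡⟨ cong (ι P *ℚ_) (ι-* n (n * b)) ⟩
      ι P *ℚ (ι n *ℚ D)                ∎)
      where
      P = (suc (suc p) * suc (suc p)) ^ n
      a = ι (suc (suc p) ^ n)
      sa≤ : s *ℚ a ≤ℚ ι (n ^ n)
      sa≤ = expSum-upper (suc (suc p)) j

    -- The inequality (p + 1)^p ≤ s p^p has exponent p = n - 3, whereas `c₀-lower` has exponent n;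
    -- three squared factors are left over on each side.
    c₀s²-lower : ι (b * (p * p) ^ 3) ≤ℚ ι (c₀ * (suc p * suc p) ^ 3) *ℚ s²
    c₀s²-lower = *-cancel-≤ˡ (0<ι ((suc p * suc p) ^ p) {{m^n≢0 (suc p * suc p) p}}) (begin
      ι ((suc p * suc p) ^ p) *ℚ ι (b * V)
        ≡⟨ cong (_*ℚ ι (b * V)) (ι-square-^ (suc p) p) ⟩
      a *ℚ a *ℚ ι (b * V)
        ≤⟨ *-mono-≤ʳ (0≤ι (b * V)) (*-mono-≤ℚ (0≤ι (suc p ^ p)) (0≤* 0≤s (0≤ι (p ^ p))) a≤ a≤) ⟩
      (s *ℚ ι (p ^ p)) *ℚ (s *ℚ ι (p ^ p)) *ℚ ι (b * V)
        ≡⟨ solve 3 (λ s c v → (s :* c) :* (s :* c) :* v := (v :* (c :* c)) :* (s :* s))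
             refl s (ι (p ^ p)) (ι (b * V)) ⟩
      ι (b * V) *ℚ (ι (p ^ p) *ℚ ι (p ^ p)) *ℚ s²
        ≡⟨ cong (_*ℚ s²) (trans (cong (ι (b * V) *ℚ_) (sym (ι-square-^ p p))) (sym (split b p))) ⟩
      ι (b * (p * p) ^ n) *ℚ s²
        ≤⟨ *-mono-≤ʳ 0≤s² (ι-mono-≤ c₀-lower) ⟩
      ι (c₀ * (suc p * suc p) ^ n) *ℚ s²
        ≡⟨ cong (_*ℚ s²) (trans (split c₀ (suc p)) (ℚ.*-comm (ι (c₀ * U)) (ι ((suc p * suc p) ^ p)))) ⟩
      ι ((suc p * suc p) ^ p) *ℚ ι (c₀ * U) *ℚ s²
        ≡⟨ ℚ.*-assoc (ι ((suc p * suc p) ^ p)) (ι (c₀ * U)) s² ⟩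
      ι ((suc p * suc p) ^ p) *ℚ (ι (c₀ * U) *ℚ s²) ∎)
      where
      U = (suc p * suc p) ^ 3
      V = (p * p) ^ 3
      a = ι (suc p ^ p)
      a≤ : a ≤ℚ s *ℚ ι (p ^ p)
      a≤ = expSum-lower l l<j
      split : ∀ c r → ι (c * (r * r) ^ (3 + p)) ≡ ι (c * (r * r) ^ 3) *ℚ ι ((r * r) ^ p)
      split c r =
        trans (cong ι (trans (cong (c *_) (^-distribˡ-+-* (r * r) 3 p)) (sym (*-assoc c ((r * r) ^ 3) ((r * r) ^ p)))))
        (ι-* (c * (r * r) ^ 3) ((r * r) ^ p))

    qs²-lower : ι n *ℚ D ≤ℚ ι q *ℚ s² +ℚ ι 13 *ℚ D
    qs²-lower = *-cancel-≤ˡ (0<ι z {{m*n≢0 ((2 + n) * suc n) U {{_}} {{m^n≢0 (suc p * suc p) 3}}}}) (begin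
      ι z *ℚ (ι n *ℚ D)
        ≡⟨ cong (ι z *ℚ_) (sym (ι-* n (n * b))) ⟩
      ι z *ℚ ι (n * (n * b))
        ≡⟨ ι-* z (n * (n * b)) ⟨
      ι (z * (n * (n * b)))
        ≡⟨ cong ι (assoc z n b) ⟩
      ι (z * (n * n) * b)
        ≤⟨ ι-mono-≤ (*-monoˡ-≤ b z-bound) ⟩
      ι (((2 + k) * suc k * V + 13 * (z * n)) * b)
        ≡⟨ cong ι (expand ((2 + k) * suc k) V b z n) ⟩
      ι ((2 + k) * suc k * (b * V) + z * (13 * (n * b)))
        ≡⟨ ι-+ ((2 + k) * suc k * (b * V)) (z * (13 * (n * b))) ⟩
      ι ((2 + k) * suc k * (b * V)) +ℚ ι (z * (13 * (n * b)))
        ≡⟨ cong₂ _+ℚ_ (ι-* ((2 + k) * suc k) (b * V)) (trans (ι-* z (13 * (n * b))) (cong (ι z *ℚ_) (ι-* 13 (n * b)))) ⟩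
      ι ((2 + k) * suc k) *ℚ ι (b * V) +ℚ ι z *ℚ (ι 13 *ℚ D)
        ≤⟨ ℚ.+-monoˡ-≤ (ι z *ℚ (ι 13 *ℚ D)) (*-mono-≤ˡ (0≤ι ((2 + k) * suc k)) c₀s²-lower) ⟩
      ι ((2 + k) * suc k) *ℚ (ι (c₀ * U) *ℚ s²) +ℚ ι z *ℚ (ι 13 *ℚ D)
        ≡⟨ cong (_+ℚ ι z *ℚ (ι 13 *ℚ D)) zqs² ⟩
      ι z *ℚ (ι q *ℚ s²) +ℚ ι z *ℚ (ι 13 *ℚ D)
        ≡⟨ ℚ.*-distribˡ-+ (ι z) (ι q *ℚ s²) (ι 13 *ℚ D) ⟨
      ι z *ℚ (ι q *ℚ s² +ℚ ι 13 *ℚ D) ∎)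
      where
      U = (suc p * suc p) ^ 3
      V = (p * p) ^ 3
      assoc : ∀ z n b → z * (n * (n * b)) ≡ z * (n * n) * b
      assoc = solve-∀
      expand : ∀ w v b z n → (w * v + 13 * (z * n)) * b ≡ w * (b * v) + z * (13 * (n * b))
      expand = solve-∀
      move : ∀ w c u → w * (c * u) ≡ w * c * u
      move = solve-∀
      move′ : ∀ w q u → w * q * u ≡ w * u * q
      move′ = solve-∀
      zqs² : ι ((2 + k) * suc k) *ℚ (ι (c₀ * U) *ℚ s²) ≡ ι z *ℚ (ι q *ℚ s²)
      zqs² = begin-equality
        ι ((2 + k) * suc k) *ℚ (ι (c₀ * U) *ℚ s²)   ≡⟨ ℚ.*-assoc (ι ((2 + k) * suc k)) (ι (c₀ * U)) s² ⟨
        ι ((2 + k) * suc k) *ℚ ι (c₀ * U) *ℚ s²     ≡⟨ cong (_*ℚ s²) (ι-* ((2 + k) * suc k) (c₀ * U)) ⟨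
        ι ((2 + k) * suc k * (c₀ * U)) *ℚ s²
          ≡⟨ cong (λ r → ι r *ℚ s²) (trans (move ((2 + k) * suc k) c₀ U) (trans (cong (_* U) (sym q-absorb)) (move′ ((2 + n) * suc n) q U))) ⟩
        ι (z * q) *ℚ s²                             ≡⟨ cong (_*ℚ s²) (ι-* z q) ⟩
        ι z *ℚ ι q *ℚ s²                            ≡⟨ ℚ.*-assoc (ι z) (ι q) s² ⟩
        ι z *ℚ (ι q *ℚ s²)                          ∎

    0<D : 0ℚ <ℚ D
    0<D = 0<ι (n * b) {{m*n≢0 n b {{_}} {{b≢0}}}}

    total : μ n *ℚ (ι n *ℚ D) ≡ ι (totalSafe n)
    total = mean-total n {{_}} {{b≢0}} (length-subsetsOfSize (n * n) n)

  μs²-upper : μ (4 + l) *ℚ s² *ℚ ι (4 + l) ≤ℚ ι 2 *ℚ ι (4 + l) +ℚ ι 128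
  μs²-upper =
    ratio-upper {μ n} {s²} {ι n} {D} {ι q} 0<D 0≤s² total (*-mono-≤ℚ 0≤s (0≤ι 4) (expSum≤4 j) (expSum≤4 j))
    (subst (ι (totalSafe n) ≤ℚ_) (trans (ι-+ (2 * q) (8 * (n * b))) (cong₂ _+ℚ_ (ι-* 2 q) (ι-* 8 (n * b))))
      (ι-mono-≤ totalSafe-upper))
    qs²-upper

  μs²-lower : ι 2 *ℚ ι (4 + l) ≤ℚ μ (4 + l) *ℚ s² *ℚ ι (4 + l) +ℚ ι 128
  μs²-lower = ratio-lower {μ n} {s²} {ι n} {D} {ι q} 0<D 0≤s² total
    (subst (_≤ℚ ι (totalSafe n)) (ι-* 2 q) (ι-mono-≤ totalSafe-lower))
    qs²-lower

archimedean : ∀ η → 0ℚ <ℚ η → ∃ λ N → ι 128 ≤ℚ ι N *ℚ η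
archimedean (mkℚ (+ zero) d c) (ℚ.*<* (ℤ.+<+ ()))
archimedean (mkℚ ℤ.-[1+ a ] d c) (ℚ.*<* ())
archimedean η@(mkℚ (+ suc a) d c) 0<η = 128 * suc d , (begin
  ι 128                          ≡⟨ ℚ.*-identityʳ (ι 128) ⟨
  ι 128 *ℚ ι 1                   ≤⟨ *-mono-≤ˡ (0≤ι 128) (ι-mono-≤ {1} {suc a} (s≤s z≤n)) ⟩
  ι 128 *ℚ ι (suc a)             ≡⟨ cong (ι 128 *ℚ_) (/-*-ι (suc a) (suc d)) ⟨
  ι 128 *ℚ ((+ suc a / suc d) *ℚ ι (suc d)) ≡⟨ cong (λ x → ι 128 *ℚ (x *ℚ ι (suc d))) (ℚ.↥p/↧p≡p η) ⟩
  ι 128 *ℚ (η *ℚ ι (suc d))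
    ≡⟨ solve 3 (λ a b c → a :* (b :* c) := a :* c :* b) refl (ι 128) η (ι (suc d)) ⟩
  ι 128 *ℚ ι (suc d) *ℚ η        ≡⟨ cong (_*ℚ η) (ι-* 128 (suc d)) ⟨
  ι (128 * suc d) *ℚ η           ∎)
  where open ℚ.≤-Reasoning

μs²-near : ∀ η → 0ℚ <ℚ η → ∃ λ N → ∀ n → .{{_ : NonZero n}} → N ≤ n → ∀ k → n ≤ k →
  ∣ μ n *ℚ (expSum k *ℚ expSum k) -ℚ ι 2 ∣ℚ ≤ℚ η
μs²-near η 0<η = let (N , 128≤) = archimedean η 0<η in
  4 ⊔ N , λ n N≤n k n≤k → beyond N 128≤ n (m⊔n≤o⇒m≤o 4 N N≤n) (m⊔n≤o⇒n≤o 4 N N≤n) k n≤k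
  where
  beyond : ∀ N → ι 128 ≤ℚ ι N *ℚ η → ∀ n → .{{_ : NonZero n}} → 4 ≤ n → N ≤ n → ∀ k → n ≤ k →
    ∣ μ n *ℚ (expSum k *ℚ expSum k) -ℚ ι 2 ∣ℚ ≤ℚ η
  beyond N 128≤ (suc (suc (suc (suc l)))) (s≤s (s≤s (s≤s (s≤s _)))) N≤n k n≤k =
    distance-≤ {μ (4 + l) *ℚ (expSum k *ℚ expSum k)} {ι 2} {ι (4 + l)} {ι 128} (0<ι (4 + l))
      (Asymptotics.μs²-upper l l<k) (Asymptotics.μs²-lower l l<k)
      (ℚ.≤-trans 128≤ (*-mono-≤ʳ (ℚ.<⇒≤ 0<η) (ι-mono-≤ N≤n)))
    where
    l<k : l < k
    l<k = ≤-trans (m≤n+m (suc l) 3) n≤k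

-- Reciprocals and passage to the real limits

recip-* : ∀ {q} → 0ℚ <ℚ q → recip q *ℚ q ≡ 1ℚ
recip-* {q} 0<q with q ℚ.≟ 0ℚ
... | yes q≡0 = contradiction (sym q≡0) (ℚ.<⇒≢ 0<q)
... | no q≢0  = ℚ.*-inverseˡ q {{ℚ.≢-nonZero q≢0}}

0≤recip : ∀ {q} → 0ℚ <ℚ q → 0ℚ ≤ℚ recip q
0≤recip {q} 0<q =
  *-cancel-≤ˡ 0<q (subst₂ _≤ℚ_ (sym (ℚ.*-zeroʳ q)) (trans (sym (recip-* 0<q)) (ℚ.*-comm (recip q) q)) (0≤ι 1))

∣p*q∣≤ : ∀ {p q η} → 0ℚ ≤ℚ q → q ≤ℚ 1ℚ → ∣ p ∣ℚ ≤ℚ η → ∣ p *ℚ q ∣ℚ ≤ℚ η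
∣p*q∣≤ {p} {q} {η} 0≤q q≤1 p≤ = begin
  ∣ p *ℚ q ∣ℚ         ≡⟨ ℚ.∣p*q∣≡∣p∣*∣q∣ p q ⟩
  ∣ p ∣ℚ *ℚ ∣ q ∣ℚ    ≡⟨ cong (∣ p ∣ℚ *ℚ_) (ℚ.0≤p⇒∣p∣≡p 0≤q) ⟩
  ∣ p ∣ℚ *ℚ q         ≤⟨ *-mono-≤ˡ (ℚ.0≤∣p∣ p) q≤1 ⟩
  ∣ p ∣ℚ *ℚ 1ℚ        ≡⟨ ℚ.*-identityʳ ∣ p ∣ℚ ⟩
  ∣ p ∣ℚ              ≤⟨ p≤ ⟩
  η                   ∎
  where open ℚ.≤-Reasoning

-- With e = E[S_n], a = n², s = s_k² and i, r, R the reciprocals of a, s and 2 a r, this turns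
-- E[S_n] / (2n²/s_k²) into μ_n s_k² / 2. The reciprocals enter only through their defining
-- products, as `recip` is defined by cases.
cancel-ratio : ∀ e i a s r R → i *ℚ a ≡ 1ℚ → r *ℚ s ≡ 1ℚ → R *ℚ (ι 2 *ℚ a *ℚ r) ≡ 1ℚ →
  e *ℚ R ≡ e *ℚ i *ℚ s *ℚ ½
cancel-ratio e i a s r R ia≡1 rs≡1 R2ar≡1 = begin
  e *ℚ R                                        ≡⟨ ℚ.*-identityʳ (e *ℚ R) ⟨
  e *ℚ R *ℚ (1ℚ *ℚ 1ℚ)                          ≡⟨ cong₂ (λ x y → e *ℚ R *ℚ (x *ℚ y)) ia≡1 rs≡1 ⟨
  e *ℚ R *ℚ ((i *ℚ a) *ℚ (r *ℚ s))
    ≡⟨ solve 6 (λ e R i a r s → e :* R :* ((i :* a) :* (r :* s)) := (e :* i :* s) :* (R :* (a :* r)))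
         refl e R i a r s ⟩
  (e *ℚ i *ℚ s) *ℚ (R *ℚ (a *ℚ r))              ≡⟨ cong (e *ℚ i *ℚ s *ℚ_) half ⟩
  e *ℚ i *ℚ s *ℚ ½                              ∎
  where
  open ≡-Reasoning
  half : R *ℚ (a *ℚ r) ≡ ½
  half = begin
    R *ℚ (a *ℚ r)
      ≡⟨ solve 3 (λ R a r → R :* (a :* r) := con ½ :* (R :* (con (ι 2) :* a :* r))) refl R a r ⟩
    ½ *ℚ (R *ℚ (ι 2 *ℚ a *ℚ r))     ≡⟨ cong (½ *ℚ_) R2ar≡1 ⟩
    ½ *ℚ 1ℚ                         ≡⟨ ℚ.*-identityʳ ½ ⟩
    ½                               ∎

module _ (k : ℕ) where

  private
    s = expSum k
    s² = s *ℚ s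
    0≤s : 0ℚ ≤ℚ s
    0≤s = ℚ.≤-trans (0≤ι 1) (1≤expSum k)
    open ℚ.≤-Reasoning

  1≤expSum² : 1ℚ ≤ℚ s²
  1≤expSum² =
    ℚ.≤-trans (1≤expSum k) (ℚ.≤-trans (ℚ.≤-reflexive (sym (ℚ.*-identityʳ s))) (*-mono-≤ˡ 0≤s (1≤expSum k)))

  0<expSum² : 0ℚ <ℚ s²
  0<expSum² = ℚ.<-≤-trans (0<ι 1) 1≤expSum²

  expSum²≤16 : s² ≤ℚ ι 16
  expSum²≤16 = ℚ.≤-trans (*-mono-≤ˡ 0≤s (expSum≤4 k)) (*-mono-≤ʳ (0≤ι 4) (expSum≤4 k))

  recip-expSum²≤1 : recip s² ≤ℚ 1ℚ
  recip-expSum²≤1 = begin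
    recip s²           ≡⟨ ℚ.*-identityʳ (recip s²) ⟨
    recip s² *ℚ 1ℚ     ≤⟨ *-mono-≤ˡ (0≤recip 0<expSum²) 1≤expSum² ⟩
    recip s² *ℚ s²     ≡⟨ recip-* 0<expSum² ⟩
    1ℚ                 ∎

  -- Apartness of 2n²/e² from 0 requires a lower bound that does not depend on k.
  1/16≤recip-expSum² : + 1 / 16 ≤ℚ recip s²
  1/16≤recip-expSum² = *-cancel-≤ˡ 0<expSum² (begin
    s² *ℚ (+ 1 / 16)     ≤⟨ *-mono-≤ʳ (ℚ.nonNegative⁻¹ (+ 1 / 16)) expSum²≤16 ⟩
    1ℚ                   ≡⟨ recip-* 0<expSum² ⟨
    recip s² *ℚ s²       ≡⟨ ℚ.*-comm (recip s²) s² ⟩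
    s² *ℚ recip s²       ∎)

  ∣μ-2/s²∣≤ : ∀ {m η} → ∣ m *ℚ s² -ℚ ι 2 ∣ℚ ≤ℚ η → ∣ m -ℚ ι 2 *ℚ recip s² ∣ℚ ≤ℚ η
  ∣μ-2/s²∣≤ {m} {η} near =
    subst (λ x → ∣ x ∣ℚ ≤ℚ η) eq (∣p*q∣≤ {m *ℚ s² -ℚ ι 2} (0≤recip 0<expSum²) recip-expSum²≤1 near)
    where
    eq : (m *ℚ s² -ℚ ι 2) *ℚ recip s² ≡ m -ℚ ι 2 *ℚ recip s²
    eq = begin-equality
      (m *ℚ s² -ℚ ι 2) *ℚ recip s²
        ≡⟨ solve 4 (λ m s t r → (m :* s :- t) :* r := m :* (r :* s) :- t :* r) refl m s² (ι 2) (recip s²) ⟩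
      m *ℚ (recip s² *ℚ s²) -ℚ ι 2 *ℚ recip s²   ≡⟨ cong (λ x → m *ℚ x -ℚ ι 2 *ℚ recip s²) (recip-* 0<expSum²) ⟩
      m *ℚ 1ℚ -ℚ ι 2 *ℚ recip s²                 ≡⟨ cong (_-ℚ ι 2 *ℚ recip s²) (ℚ.*-identityʳ m) ⟩
      m -ℚ ι 2 *ℚ recip s²                       ∎

  module _ {n : ℕ} .{{_ : NonZero n}} where

    private
      w = + (2 * (n * n)) / 1
      w≡ : w ≡ ι 2 *ℚ ι (n * n)
      w≡ = trans (ℚ.↥p/↧p≡p (ι (2 * (n * n)))) (ι-* 2 (n * n))
      1≤w : 1ℚ ≤ℚ w
      1≤w =
        subst (1ℚ ≤ℚ_) (sym (ℚ.↥p/↧p≡p (ι (2 * (n * n))))) (ι-mono-≤ {1} (>-nonZero⁻¹ (2 * (n * n)) {{m*n≢0 2 (n * n) {{_}} {{m*n≢0 n n}}}}))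

    1/16≤denominator : + 1 / 16 ≤ℚ w *ℚ recip s²
    1/16≤denominator = begin
      + 1 / 16           ≤⟨ 1/16≤recip-expSum² ⟩
      recip s²           ≡⟨ ℚ.*-identityˡ (recip s²) ⟨
      1ℚ *ℚ recip s²     ≤⟨ *-mono-≤ʳ (0≤recip 0<expSum²) 1≤w ⟩
      w *ℚ recip s²      ∎

    ratio≡ : expectedSafe n *ℚ recip (w *ℚ recip s²) ≡ μ n *ℚ s² *ℚ ½
    ratio≡ =
      cancel-ratio (expectedSafe n) ((+ 1 / (n * n)) {{m*n≢0 n n}}) (ι (n * n)) s² (recip s²) (recip (w *ℚ recip s²))
      (/-*-ι 1 (n * n) {{m*n≢0 n n}}) (recip-* 0<expSum²)
      (trans (cong (λ v → recip (w *ℚ recip s²) *ℚ (v *ℚ recip s²)) (sym w≡))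
        (recip-* (ℚ.<-≤-trans (ℚ.positive⁻¹ (+ 1 / 16)) 1/16≤denominator)))

    ∣ratio-1∣≤ : ∀ {η} → ∣ μ n *ℚ s² -ℚ ι 2 ∣ℚ ≤ℚ η → ∣ expectedSafe n *ℚ recip (w *ℚ recip s²) -ℚ 1ℚ ∣ℚ ≤ℚ η
    ∣ratio-1∣≤ {η} near = subst (λ x → ∣ x ∣ℚ ≤ℚ η) eq
      (∣p*q∣≤ {μ n *ℚ s² -ℚ ι 2} (ℚ.nonNegative⁻¹ ½) (ℚ.*≤* (ℤ.+≤+ (s≤s z≤n))) near)
      where
      eq : (μ n *ℚ s² -ℚ ι 2) *ℚ ½ ≡ expectedSafe n *ℚ recip (w *ℚ recip s²) -ℚ 1ℚ
      eq =
        trans (solve 1 (λ x → (x :- con (ι 2)) :* con ½ := x :* con ½ :- con 1ℚ) refl (μ n *ℚ s²)) (cong (_-ℚ 1ℚ) (sym ratio≡))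

-- The strict order of reals demands a positive rational gap. Of the δ that witnesses ε > 0, one
-- half bounds the distance and the other half is the gap. Closeness may start as late as k = n,
-- since for each n only large k matter.
eventually-near⇒⟶ : ∀ (a : Sequence) (L : ℝ) →
  (∀ η → 0ℚ <ℚ η → ∃ λ N → ∀ n → .{{_ : NonZero n}} → N ≤ n → ∀ k → n ≤ k →
    ∣ seq (a n) k -ℚ seq L k ∣ℚ ≤ℚ η) → a ⟶ L
eventually-near⇒⟶ a L near ε (δ , 0<δ , K , δ≤ε) =
  let (N , close) = near (½ *ℚ δ) 0<½δ in
  N , λ n N≤n → ½ *ℚ δ , 0<½δ , n ⊔ K , λ k n⊔K≤k → begin
    ∣ seq (a n) k -ℚ seq L k ∣ℚ +ℚ ½ *ℚ δ   ≤⟨ ℚ.+-monoˡ-≤ (½ *ℚ δ) (close n N≤n k (m⊔n≤o⇒m≤o n K n⊔K≤k)) ⟩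
    ½ *ℚ δ +ℚ ½ *ℚ δ                        ≡⟨ solve 1 (λ d → con ½ :* d :+ con ½ :* d := con 0ℚ :+ d) refl δ ⟩
    0ℚ +ℚ δ                                 ≤⟨ δ≤ε k (m⊔n≤o⇒n≤o n K n⊔K≤k) ⟩
    seq ε k                                 ∎
  where
  open ℚ.≤-Reasoning
  0<½δ : 0ℚ <ℚ ½ *ℚ δ
  0<½δ = subst (_<ℚ ½ *ℚ δ) (ℚ.*-zeroʳ ½) (ℚ.*-monoʳ-<-pos ½ 0<δ)

theorem1p2 : ((λ n → fromℚ (expectedSafe n)) ∼ (λ n → fromℚ (+ (2 * (n * n)) / 1) ÷ℝ e² ⟨ e²#0 ⟩))
    × ((λ n → fromℚ (μ n)) ⟶ (2ℝ ÷ℝ e² ⟨ e²#0 ⟩))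
theorem1p2 =
  (denominator#0 ,
    eventually-near⇒⟶ (λ n → fromℚ (expectedSafe n) ÷ℝ (fromℚ (+ (2 * (n * n)) / 1) ÷ℝ e² ⟨ e²#0 ⟩) ⟨ denominator#0 n ⟩) 1ℝ
      λ η 0<η → let (N , near) = μs²-near η 0<η in
        N , λ n N≤n k n≤k → ∣ratio-1∣≤ k {n} (near n N≤n k n≤k)) ,
  eventually-near⇒⟶ (λ n → fromℚ (μ n)) (2ℝ ÷ℝ e² ⟨ e²#0 ⟩)
    λ η 0<η → let (N , near) = μs²-near η 0<η in
      N , λ n N≤n k n≤k → ∣μ-2/s²∣≤ k {μ n} (near n N≤n k n≤k)
  where
  denominator#0 : ∀ n → .{{_ : NonZero n}} → (fromℚ (+ (2 * (n * n)) / 1) ÷ℝ e² ⟨ e²#0 ⟩) # 0ℝ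
  denominator#0 n = inj₂ (+ 1 / 16 , ℚ.positive⁻¹ (+ 1 / 16) , 0 , λ k _ →
    ℚ.≤-trans (ℚ.≤-reflexive (ℚ.+-identityˡ (+ 1 / 16))) (1/16≤denominator k {n}))
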